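{- Let $n$ be a nonnegative integer such that $2n+1$ is prime. Then \[ \sum_{j=0}^{n-1} t_4(j) \left( \sigma(n-j) - 4\sigma\!\left(\tfrac{n-j}{2}\right) \right) = \frac{n(n+1)}{2}. \]
   Context: $t_4(m)=\#\{(x_1,\dots,x_4)\in\mathbb{N}_0^4 : m=\sum_{i=1}^4\frac{x_i(x_i+1)}{2}\}$, with $\mathbb{N}_0=\{0,1,2,\dots\}$ (so $t_4(0)=1$). The function $\sigma$ is defined on $\mathbb{Q}$ by $\sigma(0)=1$, $\sigma(q)=0$ if $q\in\mathbb{Q}\setminus\mathbb{N}_0$, and $\sigma(q)=\sum_{d\mid q} d$ for $q\in\mathbb{N}=\{1,2,\dots\}$. -}

module Defs where

open import Data.Nat as ℕ using (ℕ; zero; suc; _+_; _*_; _∸_; _/_; _≟_)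
open import Data.Nat.Divisibility using (_∣?_)
open import Data.Integer as ℤ using (ℤ; +_; -[1+_])
open import Data.Rational as ℚ using (ℚ)
open import Data.List using (List; []; _∷_; upTo; filter; length; map; concatMap)
open import Data.Nat.ListAction using (sum)
open import Data.Product using (_×_; _,_)
open import Relation.Nullary.Decidable using (does)
open import Data.Bool using (true; false)

tri : ℕ → ℕ
tri x = (x * suc x) / 2

-- t₄(m) = #{(x₁,…,x₄) ∈ ℕ₀⁴ : m = Σ tri xᵢ}.
-- Since tri x ≥ x, every solution has all xᵢ ≤ m, so enumerating
-- xᵢ ∈ {0,…,m} counts exactly the solutions.
quads : ℕ → List (ℕ × ℕ × ℕ × ℕ)
quads m = concatMap (λ a → concatMap (λ b → concatMap (λ c → map (λ d → a , b , c , d)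
            (upTo (suc m))) (upTo (suc m))) (upTo (suc m))) (upTo (suc m))

t₄ : ℕ → ℕ
t₄ m = length (filter (λ { (a , b , c , d) → m ≟ tri a + tri b + tri c + tri d }) (quads m))

σℕ : ℕ → ℕ
σℕ k = sum (filter (λ d → d ∣? k) (upTo (suc k)))

σ : ℚ → ℕ
σ q with ℚ.denominatorℕ q | ℚ.numerator q
... | 1 | + zero    = 1
... | 1 | + (suc k) = σℕ (suc k)
... | 1 | -[1+ _ ]  = 0
... | _ | _         = 0

ℕ→ℚ : ℕ → ℚ
ℕ→ℚ k = (+ k) ℚ./ 1

Σ<_ : ℕ → (ℕ → ℤ) → ℤ
(Σ< zero) f = + 0
(Σ< suc n) f = (Σ< n) f ℤ.+ f n

{-# OPTIONS --safe #-}

-- Put ψ(q) = Σ q^(k(k+1)/2) and A(m) = Σ_{d∣m} (−1)^(d−1) d = σ(m) − 4σ(m/2). Two identities hold by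
-- bijections on solution sets of Diophantine equations:
--   q ψ′ = ψ · Σ A(m) q^m                                (sign-reversing involutions on k(k+1) + 2de = 2n),
--   4 Σ_{j<n} σ(2j+1) A(n−j) = n σ(2n+1)                 (Liouville's method on ax + by = 2n + 1).
-- The first gives n t₄(n) = 4 Σ_{j<n} t₄(j) A(n−j) by the product rule for ψ⁴. This recursion is also satisfied
-- by σ(2n+1), so t₄(n) = σ(2n+1), which is 2n + 2 when 2n + 1 is prime, and the sum is n t₄(n) / 4.
module Submission where

open import Defs
open import Data.Empty using (⊥-elim)
open import Data.Integer using (ℤ; +_; -[1+_]; 0ℤ; 1ℤ; ∣_∣; _<_; +<+; _+_; _*_; _-_; -_)
import Data.Integer.Properties as ℤₚ
open import Algebra.Properties.AbelianGroup ℤₚ.+-0-abelianGroup using (∙-cancelˡ)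
open import Data.Integer.Tactic.RingSolver using (solve-∀)
open import Data.List using (List; []; _∷_; _++_; length; map; filter; concatMap; downFrom; upTo)
open import Data.List.Membership.Propositional using (_∈_; find; lose)
open import Data.List.Membership.Propositional.Properties
  using (∈-filter⁺; ∈-filter⁻; ∈-map⁻; ∈-map⁺; ∈-++⁺ˡ; ∈-++⁺ʳ; ∈-++⁻; ∈-concatMap⁺; ∈-concatMap⁻;
         ∈-downFrom⁺; ∈-downFrom⁻; ∈-upTo⁺; ∈-upTo⁻)
open import Data.List.Membership.Propositional.Properties.WithK using (unique∧set⇒bag)
open import Data.List.Relation.Binary.BagAndSetEquality using (∼bag⇒↭)
open import Data.List.Relation.Binary.Permutation.Propositional as ↭ using (_↭_)
open import Data.List.Relation.Unary.All as All using (All; []; _∷_)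
import Data.List.Relation.Unary.All.Properties as Allₚ
open import Data.List.Relation.Unary.AllPairs as AllPairs using ([]; _∷_)
import Data.List.Relation.Unary.AllPairs.Properties as AllPairsₚ
open import Data.List.Relation.Unary.Any using (here; there)
open import Data.List.Relation.Unary.Unique.Propositional using (Unique)
import Data.List.Relation.Unary.Unique.Propositional.Properties as Uniqueₚ
open import Data.Nat as ℕ using (ℕ; zero; suc)
import Data.Nat.Coprimality as Coprime
open import Data.Nat.Divisibility
  using (_∣_; _∣?_; divides; divides-refl; ∣⇒≤; ∣-trans; ∣m+n∣m⇒∣n; ∣1⇒≡1; m∣m*n)
import Data.Nat.DivMod as DM
open import Data.Nat.Induction using (<-rec)
open import Data.Nat.ListAction using (sum)
open import Data.Nat.Primality using (Prime; prime⇒irreducible; prime⇒nonTrivial)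
import Data.Nat.Properties as ℕₚ
import Data.Nat.Tactic.RingSolver as ℕR
open import Data.Product using (∃; ∃₂; _×_; _,_; proj₁; proj₂)
open import Data.Rational as ℚ using ()
import Data.Rational.Properties as ℚₚ
open import Data.Rational.Unnormalised using (mkℚᵘ; *≡*)
open import Data.Sum using (_⊎_; inj₁; inj₂)
open import Function.Bundles using (mk⇔)
open import Relation.Binary.PropositionalEquality
  using (_≡_; _≢_; refl; sym; trans; cong; cong₂; subst; subst₂; module ≡-Reasoning)
open import Relation.Nullary using (¬_; Dec; yes; no)
open import Relation.Nullary.Decidable using (_×-dec_; ¬?)
open import Relation.Unary using (Decidable)

-- Finite sums over enumerated sets

-- Under the three maps applied to triples `(k , d , e)`, the summand `(-1)^(d-1) d` alone does not
-- simply change sign. Replacing `d` by `2d + (2k + 1)` cures this: each map keeps or negates that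
-- factor, and the surplus `2k + 1` cancels in the total because `k ↦ -k-1` negates it. What the
-- maps leave out lies on two boundary regions where `8n + 1` is a square; their total is the
-- coefficient of `q ψ′`. In the second identity everything depends on the test function.
-- Liouville's method turns `f(a - b) - f(a + b)`, summed over `ax + by = N`, into sums over the
-- divisors of `N`. A quadratic `f` produces the products `ab`, hence a convolution of divisor sums,
-- but in general leaves cubes of divisors behind. Coefficients that depend on parity, in the ratio
-- `3 : 5`, remove the cubes. No power series occur: each coefficient is a finite sum over the
-- solutions of a condition, and each identity compares such solution sets.

infix 5 ∑
∑ : {A : Set} → List A → (A → ℤ) → ℤ
∑ []       f = 0ℤ
∑ (x ∷ xs) f = f x + ∑ xs f

syntax ∑ xs (λ x → e) = ∑[ x ∈ xs ] e

module _ {A : Set} where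

  ∑-cong-∈ : {f g : A → ℤ} (xs : List A) → (∀ x → x ∈ xs → f x ≡ g x) → ∑ xs f ≡ ∑ xs g
  ∑-cong-∈ []       eq = refl
  ∑-cong-∈ (x ∷ xs) eq = cong₂ _+_ (eq x (here refl)) (∑-cong-∈ xs λ y y∈ → eq y (there y∈))

  ∑-cong : {f g : A → ℤ} (xs : List A) → (∀ x → f x ≡ g x) → ∑ xs f ≡ ∑ xs g
  ∑-cong xs eq = ∑-cong-∈ xs λ x _ → eq x

  ∑-zero : (xs : List A) → ∑ xs (λ _ → 0ℤ) ≡ 0ℤ
  ∑-zero []       = refl
  ∑-zero (x ∷ xs) = trans (ℤₚ.+-identityˡ _) (∑-zero xs)

  ∑-+ : (f g : A → ℤ) (xs : List A) → ∑ xs (λ x → f x + g x) ≡ ∑ xs f + ∑ xs g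
  ∑-+ f g []       = refl
  ∑-+ f g (x ∷ xs) = trans (cong (λ s → f x + g x + s) (∑-+ f g xs)) (interchange (f x) (g x) _ _)
    where
    interchange : ∀ a b c d → a + b + (c + d) ≡ a + c + (b + d)
    interchange = solve-∀

  ∑-*ˡ : (c : ℤ) (f : A → ℤ) (xs : List A) → ∑ xs (λ x → c * f x) ≡ c * ∑ xs f
  ∑-*ˡ c f []       = sym (ℤₚ.*-zeroʳ c)
  ∑-*ˡ c f (x ∷ xs) = trans (cong (λ s → c * f x + s) (∑-*ˡ c f xs)) (sym (ℤₚ.*-distribˡ-+ c _ _))

  ∑-*ʳ : (c : ℤ) (f : A → ℤ) (xs : List A) → ∑ xs (λ x → f x * c) ≡ ∑ xs f * c
  ∑-*ʳ c f xs = trans (∑-cong xs λ x → ℤₚ.*-comm (f x) c) (trans (∑-*ˡ c f xs) (ℤₚ.*-comm c _))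

  ∑-↭ : (f : A → ℤ) {xs ys : List A} → xs ↭ ys → ∑ xs f ≡ ∑ ys f
  ∑-↭ f ↭.refl          = refl
  ∑-↭ f (↭.prep x p)    = cong (λ s → f x + s) (∑-↭ f p)
  ∑-↭ f (↭.swap x y p)  = trans (cong (λ s → f x + (f y + s)) (∑-↭ f p)) (left-comm (f x) (f y) _)
    where
    left-comm : ∀ a b c → a + (b + c) ≡ b + (a + c)
    left-comm = solve-∀
  ∑-↭ f (↭.trans p q)   = trans (∑-↭ f p) (∑-↭ f q)

  ∑-++ : (f : A → ℤ) (xs ys : List A) → ∑ (xs ++ ys) f ≡ ∑ xs f + ∑ ys f
  ∑-++ f []       ys = sym (ℤₚ.+-identityˡ _)
  ∑-++ f (x ∷ xs) ys = trans (cong (λ s → f x + s) (∑-++ f xs ys)) (sym (ℤₚ.+-assoc (f x) _ _))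

ind : {P : Set} → Dec P → ℤ → ℤ
ind (yes _) z = z
ind (no _)  z = 0ℤ

ind-true : {P : Set} (d : Dec P) {z : ℤ} → P → ind d z ≡ z
ind-true (yes _) p = refl
ind-true (no ¬p) p = ⊥-elim (¬p p)

ind-false : {P : Set} (d : Dec P) {z : ℤ} → ¬ P → ind d z ≡ 0ℤ
ind-false (yes p) ¬p = ⊥-elim (¬p p)
ind-false (no _)  ¬p = refl

ind-*ˡ : {P : Set} (d : Dec P) (c z : ℤ) → ind d (c * z) ≡ c * ind d z
ind-*ˡ (yes _) c z = refl
ind-*ˡ (no _)  c z = sym (ℤₚ.*-zeroʳ c)

module _ {A B : Set} where

  ∑-map : (f : B → ℤ) (g : A → B) (xs : List A) → ∑ (map g xs) f ≡ ∑ xs (λ x → f (g x))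
  ∑-map f g []       = refl
  ∑-map f g (x ∷ xs) = cong (λ s → f (g x) + s) (∑-map f g xs)

  ∑-concatMap : (f : B → ℤ) (g : A → List B) (xs : List A) →
                ∑ (concatMap g xs) f ≡ ∑ xs (λ x → ∑ (g x) f)
  ∑-concatMap f g []       = refl
  ∑-concatMap f g (x ∷ xs) = trans (∑-++ f (g x) _) (cong (λ s → ∑ (g x) f + s) (∑-concatMap f g xs))

  ∑-swap : (f : A → B → ℤ) (xs : List A) (ys : List B) →
           ∑ xs (λ x → ∑ ys (f x)) ≡ ∑ ys (λ y → ∑ xs (λ x → f x y))
  ∑-swap f []       ys = sym (∑-zero ys)
  ∑-swap f (x ∷ xs) ys = trans (cong (λ s → ∑ ys (f x) + s) (∑-swap f xs ys)) (sym (∑-+ (f x) _ ys))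

∑-filter : {A : Set} {P : A → Set} (P? : Decidable P) (f : A → ℤ) (xs : List A) →
           ∑ (filter P? xs) f ≡ ∑ xs (λ x → ind (P? x) (f x))
∑-filter P? f []       = refl
∑-filter P? f (x ∷ xs) with P? x
... | yes _ = cong (λ s → f x + s) (∑-filter P? f xs)
... | no  _ = trans (∑-filter P? f xs) (sym (ℤₚ.+-identityˡ _))

-- Duplicate-free, sound and complete lists for one predicate agree up to permutation. Hence a sum
-- over such a list depends on the predicate alone, and bijections need only respect predicates,
-- never the order of a list.
record Enum {A : Set} (P : A → Set) : Set where
  field
    list     : List A
    unique   : Unique list
    sound    : ∀ {x} → x ∈ list → P x
    complete : ∀ {x} → P x → x ∈ list

open Enum

∑ᴱ : {A : Set} {P : A → Set} → Enum P → (A → ℤ) → ℤ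
∑ᴱ E = ∑ (list E)

∑ᴱ-cong : {A : Set} {P : A → Set} (E : Enum P) {f g : A → ℤ} →
          (∀ x → P x → f x ≡ g x) → ∑ᴱ E f ≡ ∑ᴱ E g
∑ᴱ-cong E eq = ∑-cong-∈ (list E) λ x x∈ → eq x (sound E x∈)

module _ {A B : Set} where

  private
    map-unique : (φ : A → B) (xs : List A) → (∀ {x y} → x ∈ xs → y ∈ xs → φ x ≡ φ y → x ≡ y) →
                 Unique xs → Unique (map φ xs)
    map-unique φ []       inj _            = []
    map-unique φ (x ∷ xs) inj (x∉xs ∷ xs!) =
      fresh xs there x∉xs ∷ map-unique φ xs (λ p q → inj (there p) (there q)) xs!
      where
      fresh : ∀ ys → (∀ {y} → y ∈ ys → y ∈ x ∷ xs) → All (x ≢_) ys → All (φ x ≢_) (map φ ys)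
      fresh []       sub []         = []
      fresh (y ∷ ys) sub (x≢y ∷ ps) =
        (λ eq → x≢y (inj (here refl) (sub (here refl)) eq)) ∷ fresh ys (λ p → sub (there p)) ps

  -- The image of `list E` under `φ` and `list F` are duplicate-free with the same members, hence
  -- equal as bags. The inverse laws are asked for only on the predicates, so lossy maps such as
  -- `∣_∣` or `half` can serve as inverses there.
  reindex : {P : A → Set} {Q : B → Set} (E : Enum P) (F : Enum Q) {f : A → ℤ} {g : B → ℤ}
            (φ : A → B) (ψ : B → A) →
            (∀ x → P x → Q (φ x)) → (∀ y → Q y → P (ψ y)) →
            (∀ x → P x → ψ (φ x) ≡ x) → (∀ y → Q y → φ (ψ y) ≡ y) →
            (∀ x → P x → f x ≡ g (φ x)) → ∑ᴱ E f ≡ ∑ᴱ F g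
  reindex E F {f} {g} φ ψ φ-ok ψ-ok ψφ φψ eq = begin
    ∑ᴱ E f                   ≡⟨ ∑ᴱ-cong E eq ⟩
    ∑ᴱ E (λ x → g (φ x))     ≡⟨ ∑-map g φ (list E) ⟨
    ∑ (map φ (list E)) g     ≡⟨ ∑-↭ g (∼bag⇒↭ (unique∧set⇒bag unique-map (unique F) (mk⇔ to from))) ⟩
    ∑ᴱ F g                   ∎
    where
    open ≡-Reasoning
    unique-map : Unique (map φ (list E))
    unique-map = map-unique φ (list E)
      (λ x∈ y∈ e → trans (sym (ψφ _ (sound E x∈))) (trans (cong ψ e) (ψφ _ (sound E y∈))))
      (unique E)
    to : ∀ {y} → y ∈ map φ (list E) → y ∈ list F
    to y∈ with x , x∈ , refl ← ∈-map⁻ φ y∈ = complete F (φ-ok x (sound E x∈))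
    from : ∀ {y} → y ∈ list F → y ∈ map φ (list E)
    from {y} y∈ = subst (_∈ map φ (list E)) (φψ y (sound F y∈))
                    (∈-map⁺ φ (complete E (ψ-ok y (sound F y∈))))

reindex-id : {A : Set} {P Q : A → Set} (E : Enum P) (F : Enum Q) {f : A → ℤ} →
             (∀ x → P x → Q x) → (∀ x → Q x → P x) → ∑ᴱ E f ≡ ∑ᴱ F f
reindex-id E F to from =
  reindex E F (λ x → x) (λ x → x) to from (λ _ _ → refl) (λ _ _ → refl) (λ _ _ → refl)

module _ {A : Set} {P : A → Set} where

  infixl 6 _∩_
  _∩_ : Enum P → {R : A → Set} → Decidable R → Enum (λ x → P x × R x)
  list     (E ∩ R?)          = filter R? (list E)
  unique   (E ∩ R?)          = Uniqueₚ.filter⁺ R? (unique E)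
  sound    (E ∩ R?) x∈       = let x∈E , r = ∈-filter⁻ R? x∈ in sound E x∈E , r
  complete (E ∩ R?) (p , r)  = ∈-filter⁺ R? (complete E p) r

  split : (E : Enum P) {R : A → Set} (R? : Decidable R) (f : A → ℤ) →
          ∑ᴱ E f ≡ ∑ᴱ (E ∩ R?) f + ∑ᴱ (E ∩ λ x → ¬? (R? x)) f
  split E R? f = begin
    ∑ᴱ E f                                                        ≡⟨ ∑-cong (list E) (λ x → pick (R? x) (f x)) ⟩
    ∑ᴱ E (λ x → ind (R? x) (f x) + ind (¬? (R? x)) (f x))         ≡⟨ ∑-+ _ _ (list E) ⟩
    ∑ᴱ E (λ x → ind (R? x) (f x)) + ∑ᴱ E (λ x → ind (¬? (R? x)) (f x))
      ≡⟨ cong₂ _+_ (∑-filter R? f (list E)) (∑-filter (λ x → ¬? (R? x)) f (list E)) ⟨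
    ∑ᴱ (E ∩ R?) f + ∑ᴱ (E ∩ λ x → ¬? (R? x)) f                    ∎
    where
    open ≡-Reasoning
    pick : {R : Set} (d : Dec R) (z : ℤ) → z ≡ ind d z + ind (¬? d) z
    pick (yes _) z = sym (ℤₚ.+-identityʳ z)
    pick (no _)  z = sym (ℤₚ.+-identityˡ z)

  -- Reindexing along `ι` shows that the sum is its own negative. At a fixed point of `ι` the
  -- hypothesis forces the value 0.
  ∑ᴱ-antisym : (E : Enum P) {f : A → ℤ} (ι : A → A) → (∀ x → P x → P (ι x)) →
               (∀ x → P x → ι (ι x) ≡ x) → (∀ x → P x → f x ≡ - f (ι x)) → ∑ᴱ E f ≡ 0ℤ
  ∑ᴱ-antisym E {f} ι ι-ok ιι eq = self-neg _ (begin
    ∑ᴱ E f                    ≡⟨ reindex E E ι ι ι-ok ι-ok ιι ιι eq ⟩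
    ∑ᴱ E (λ x → - f x)        ≡⟨ ∑-cong (list E) (λ x → sym (ℤₚ.-1*i≡-i (f x))) ⟩
    ∑ᴱ E (λ x → - 1ℤ * f x)   ≡⟨ ∑-*ˡ (- 1ℤ) f (list E) ⟩
    - 1ℤ * ∑ᴱ E f             ≡⟨ ℤₚ.-1*i≡-i _ ⟩
    - ∑ᴱ E f                  ∎)
    where
    open ≡-Reasoning
    self-neg : ∀ z → z ≡ - z → z ≡ 0ℤ
    -- For nonzero `z` the constructors of `z` and `- z` differ, so those cases are absurd.
    self-neg (+ zero) _ = refl

-- Equivalent to 0 < z; with + suc n as index, closure under _+_ and _*_ holds by computation.
data Pos : ℤ → Set where
  pos : ∀ n → Pos (+ suc n)

pos? : Decidable Pos
pos? (+ zero)  = no λ ()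
pos? (+ suc n) = yes (pos n)
pos? -[1+ n ]  = no λ ()

Pos-+ : ∀ {x y} → Pos x → Pos y → Pos (x + y)
Pos-+ (pos m) (pos n) = pos _

Pos-* : ∀ {x y} → Pos x → Pos y → Pos (x * y)
Pos-* (pos m) (pos n) = pos _

zero? : Decidable (_≡ 0ℤ)
zero? z = z ℤₚ.≟ 0ℤ

split-sign : {A : Set} {P : A → Set} (E : Enum P) (h : A → ℤ) (f : A → ℤ) →
  ∑ᴱ E f ≡ ∑ᴱ (E ∩ (λ x → pos? (h x))) f
           + (∑ᴱ (E ∩ (λ x → zero? (h x))) f + ∑ᴱ (E ∩ (λ x → pos? (- h x))) f)
split-sign E h f = begin
  ∑ᴱ E f  ≡⟨ ∑-cong (list E) (λ x → pick (h x) (f x)) ⟩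
  ∑ᴱ E (λ x → ind (pos? (h x)) (f x) + (ind (zero? (h x)) (f x) + ind (pos? (- h x)) (f x)))
    ≡⟨ ∑-+ _ _ (list E) ⟩
  ∑ᴱ E (λ x → ind (pos? (h x)) (f x)) + ∑ᴱ E (λ x → ind (zero? (h x)) (f x) + ind (pos? (- h x)) (f x))
    ≡⟨ cong₂ _+_ (sym (∑-filter _ f (list E))) (trans (∑-+ _ _ (list E))
         (sym (cong₂ _+_ (∑-filter _ f (list E)) (∑-filter _ f (list E))))) ⟩
  _ ∎
  where
  open ≡-Reasoning
  pick : ∀ h z → z ≡ ind (pos? h) z + (ind (zero? h) z + ind (pos? (- h)) z)
  pick (+ zero)  z = sym (trans (ℤₚ.+-identityˡ _) (ℤₚ.+-identityʳ z))
  pick (+ suc n) z = sym (ℤₚ.+-identityʳ z)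
  pick -[1+ n ]  z = sym (trans (ℤₚ.+-identityˡ _) (ℤₚ.+-identityˡ z))

below : (n : ℕ) → Enum (ℕ._< n)
list     (below n) = downFrom n
unique   (below n) = Uniqueₚ.downFrom⁺ n
sound    (below n) = ∈-downFrom⁻
complete (below n) = ∈-downFrom⁺

-- Turns a bound on the solutions into an enumeration: a finite box is filtered by the condition. In
-- contrast to `_∩_`, the box does not survive in the predicate.
restrict : {A : Set} {P Q : A → Set} → Enum P → Decidable Q → (∀ x → Q x → P x) → Enum Q
list     (restrict E Q? Q⊆P)   = filter Q? (list E)
unique   (restrict E Q? Q⊆P)   = Uniqueₚ.filter⁺ Q? (unique E)
sound    (restrict E Q? Q⊆P) x∈ = proj₂ (∈-filter⁻ Q? {xs = list E} x∈)
complete (restrict E Q? Q⊆P) q  = ∈-filter⁺ Q? (complete E (Q⊆P _ q)) q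

module _ {A B : Set} {P : A → Set} {R : A → B → Set} where

  infixr 5 _▹_
  _▹_ : Enum P → (∀ a → Enum (R a)) → Enum (λ ab → P (proj₁ ab) × R (proj₁ ab) (proj₂ ab))
  list (E ▹ F) = concatMap (λ a → map (a ,_) (list (F a))) (list E)
  unique (E ▹ F) = Uniqueₚ.concat⁺
    (Allₚ.map⁺ (All.tabulate λ {a} _ → Uniqueₚ.map⁺ (λ { refl → refl }) (unique (F a))))
    (AllPairsₚ.map⁺ (AllPairs.map disjoint (unique E)))
    where
    disjoint : ∀ {a a′} → a ≢ a′ → ∀ {ab} → ¬ (ab ∈ map (a ,_) (list (F a)) × ab ∈ map (a′ ,_) (list (F a′)))
    disjoint a≢a′ (p , q)
      with _ , _ , refl ← ∈-map⁻ _ p | _ , _ , refl ← ∈-map⁻ _ q = a≢a′ refl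
  sound (E ▹ F) ab∈
    with a , a∈ , p ← find (∈-concatMap⁻ (λ a → map (a ,_) (list (F a))) {xs = list E} ab∈)
    with b , b∈ , refl ← ∈-map⁻ (a ,_) p = sound E a∈ , sound (F a) b∈
  complete (E ▹ F) (p , r) =
    ∈-concatMap⁺ (λ a → map (a ,_) (list (F a)))
      (lose (complete E p) (∈-map⁺ _ (complete (F _) r)))

  ∑-▹ : (E : Enum P) (F : ∀ a → Enum (R a)) (f : A × B → ℤ) →
        ∑ᴱ (E ▹ F) f ≡ ∑[ a ∈ list E ] ∑[ b ∈ list (F a) ] f (a , b)
  ∑-▹ E F f = trans (∑-concatMap f _ (list E)) (∑-cong (list E) λ a → ∑-map f (a ,_) (list (F a)))

infixr 5 _⊗_
_⊗_ : {A B : Set} {P : A → Set} {Q : B → Set} → Enum P → Enum Q →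
      Enum (λ ab → P (proj₁ ab) × Q (proj₂ ab))
E ⊗ F = E ▹ λ _ → F

∑-⊗ : {A B : Set} {P : A → Set} {Q : B → Set} (E : Enum P) (F : Enum Q) (f : A → ℤ) (g : B → ℤ) →
      ∑ᴱ (E ⊗ F) (λ ab → f (proj₁ ab) * g (proj₂ ab)) ≡ ∑ᴱ E f * ∑ᴱ F g
∑-⊗ E F f g = trans (∑-▹ E (λ _ → F) _)
  (trans (∑-cong (list E) λ a → ∑-*ˡ (f a) g (list F)) (∑-*ʳ (∑ᴱ F g) f (list E)))

ball : (K : ℕ) → Enum (λ x → ∣ x ∣ ℕ.≤ K)
list (ball K) = map +_ (downFrom (suc K)) ++ map -[1+_] (downFrom K)
unique (ball K) = Uniqueₚ.++⁺ (Uniqueₚ.map⁺ ℤₚ.+-injective (Uniqueₚ.downFrom⁺ (suc K)))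
                              (Uniqueₚ.map⁺ ℤₚ.-[1+-injective (Uniqueₚ.downFrom⁺ K)) disjoint
  where
  disjoint : ∀ {x} → ¬ (x ∈ map +_ (downFrom (suc K)) × x ∈ map -[1+_] (downFrom K))
  disjoint (p , q) with _ , _ , refl ← ∈-map⁻ +_ p | _ , _ , () ← ∈-map⁻ -[1+_] q
sound (ball K) x∈ with ∈-++⁻ (map +_ (downFrom (suc K))) x∈
... | inj₁ p with _ , n∈ , refl ← ∈-map⁻ +_ p = ℕₚ.≤-pred (∈-downFrom⁻ n∈)
... | inj₂ q with _ , n∈ , refl ← ∈-map⁻ -[1+_] q = ∈-downFrom⁻ n∈
complete (ball K) { + n }     n≤K = ∈-++⁺ˡ (∈-map⁺ +_ (∈-downFrom⁺ (ℕ.s≤s n≤K)))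
complete (ball K) { -[1+ n ]} n<K = ∈-++⁺ʳ (map +_ (downFrom (suc K))) (∈-map⁺ -[1+_] (∈-downFrom⁺ n<K))

-- Parity signs and triangular numbers

εℕ : ℕ → ℤ
εℕ zero    = 1ℤ
εℕ (suc n) = - εℕ n

-- The character `(-1)^x` on all of ℤ. It is both the sign occurring in the sums and the test for
-- parity.
ε : ℤ → ℤ
ε (+ n)    = εℕ n
ε -[1+ n ] = - εℕ n

ε-suc : ∀ x → ε (1ℤ + x) ≡ - ε x
ε-suc (+ n)         = refl
ε-suc -[1+ zero ]   = refl
ε-suc -[1+ suc n ]  = sym (trans (ℤₚ.neg-involutive _) refl)

ε-pred : ∀ x → ε (- 1ℤ + x) ≡ - ε x
ε-pred x = sym (trans (cong -_ (trans (cong ε (shift x)) (ε-suc (- 1ℤ + x)))) (ℤₚ.neg-involutive _))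
  where
  shift : ∀ x → x ≡ 1ℤ + (- 1ℤ + x)
  shift = solve-∀

ε-+ : ∀ x y → ε (x + y) ≡ ε x * ε y
ε-+ (+ zero)    y = trans (cong ε (ℤₚ.+-identityˡ y)) (sym (ℤₚ.*-identityˡ _))
ε-+ (+ suc n)   y = begin
  ε (+ suc n + y)       ≡⟨ cong ε (ℤₚ.+-assoc 1ℤ (+ n) y) ⟩
  ε (1ℤ + (+ n + y))    ≡⟨ ε-suc (+ n + y) ⟩
  - ε (+ n + y)         ≡⟨ cong -_ (ε-+ (+ n) y) ⟩
  - (ε (+ n) * ε y)     ≡⟨ ℤₚ.neg-distribˡ-* (ε (+ n)) (ε y) ⟩
  - ε (+ n) * ε y       ∎
  where open ≡-Reasoning
ε-+ -[1+ zero ] y = trans (ε-pred y) (sym (ℤₚ.-1*i≡-i _))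
ε-+ -[1+ suc n ] y = begin
  ε (-[1+ suc n ] + y)            ≡⟨ cong ε (ℤₚ.+-assoc (- 1ℤ) -[1+ n ] y) ⟩
  ε (- 1ℤ + (-[1+ n ] + y))       ≡⟨ ε-pred (-[1+ n ] + y) ⟩
  - ε (-[1+ n ] + y)              ≡⟨ cong -_ (ε-+ -[1+ n ] y) ⟩
  - (- ε (+ n) * ε y)             ≡⟨ ℤₚ.neg-distribˡ-* (- ε (+ n)) (ε y) ⟩
  - - ε (+ n) * ε y               ∎
  where open ≡-Reasoning

ε-neg : ∀ x → ε (- x) ≡ ε x
ε-neg (+ zero)  = refl
ε-neg (+ suc n) = refl
ε-neg -[1+ n ]  = refl

ε-values : ∀ x → ε x ≡ 1ℤ ⊎ ε x ≡ - 1ℤ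
ε-values (+ zero) = inj₁ refl
ε-values (+ suc n) with ε-values (+ n)
... | inj₁ p = inj₂ (cong -_ p)
... | inj₂ p = inj₁ (cong -_ p)
ε-values -[1+ zero ] = inj₂ refl
ε-values -[1+ suc n ] with ε-values -[1+ n ]
... | inj₁ p = inj₂ (cong -_ p)
... | inj₂ p = inj₁ (cong -_ p)

ε-double : ∀ x → ε (x + x) ≡ 1ℤ
ε-double x = trans (ε-+ x x) (square (ε-values x))
  where
  square : ∀ {z} → z ≡ 1ℤ ⊎ z ≡ - 1ℤ → z * z ≡ 1ℤ
  square (inj₁ refl) = refl
  square (inj₂ refl) = refl

ε-odd : ∀ x → ε (1ℤ + (x + x)) ≡ - 1ℤ
ε-odd x = trans (ε-suc (x + x)) (cong -_ (ε-double x))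

ε-+double : ∀ x y → ε (x + (y + y)) ≡ ε x
ε-+double x y = trans (ε-+ x (y + y)) (trans (cong (ε x *_) (ε-double y)) (ℤₚ.*-identityʳ _))

Pos-odd⇒ℕ : ∀ x → Pos (+ 2 * x + 1ℤ) → ∃ λ m → x ≡ + m
Pos-odd⇒ℕ (+ m)    _ = m , refl
Pos-odd⇒ℕ -[1+ m ] p = ⊥-elim (absurd m (subst Pos (reshape -[1+ m ]) p))
  where
  reshape : ∀ x → + 2 * x + 1ℤ ≡ (x + 1ℤ) + x
  reshape = solve-∀
  absurd : ∀ m → ¬ Pos (-[1+ m ] + 1ℤ + -[1+ m ])
  absurd zero    ()
  absurd (suc m) ()

tri-suc : ∀ k → tri (suc k) ≡ suc k ℕ.+ tri k
tri-suc k = trans (DM./-congˡ {o = 2} (shape k)) (trans (DM.+-distrib-/-∣ˡ {suc k ℕ.* 2} (k ℕ.* suc k) (divides-refl (suc k))) (cong (ℕ._+ tri k) (DM.m*n/n≡m (suc k) 2)))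
  where
  shape : ∀ k → suc k ℕ.* suc (suc k) ≡ suc k ℕ.* 2 ℕ.+ k ℕ.* suc k
  shape = ℕR.solve-∀

2*tri : ∀ k → 2 ℕ.* tri k ≡ k ℕ.* suc k
2*tri zero = refl
2*tri (suc k) = trans (cong (2 ℕ.*_) (tri-suc k)) (trans (ℕₚ.*-distribˡ-+ 2 (suc k) (tri k)) (trans (cong (2 ℕ.* suc k ℕ.+_) (2*tri k)) (shape k)))
  where
  shape : ∀ k → 2 ℕ.* suc k ℕ.+ k ℕ.* suc k ≡ suc k ℕ.* suc (suc k)
  shape = ℕR.solve-∀

k≤tri : ∀ k → k ℕ.≤ tri k
k≤tri zero = ℕ.z≤n
k≤tri (suc k) = ℕₚ.≤-trans (ℕₚ.m≤m+n (suc k) (tri k)) (ℕₚ.≤-reflexive (sym (tri-suc k)))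

-- The logarithmic derivative of ψ

ℤ³ : Set
ℤ³ = ℤ × ℤ × ℤ

module _ (n : ℕ) where

  -- Twice the equation `tri k + d e = n`. The index `k` runs over all integers because the maps
  -- below do not respect its sign; `k` and `-k-1` give the same triangular number.
  InX : ℤ³ → Set
  InX (k , d , e) = Pos d × Pos e × k * (k + 1ℤ) + + 2 * (d * e) ≡ + 2 * + n

  private
    pronic : ∀ k → ∃ λ m → k * (k + 1ℤ) ≡ + (m ℕ.* suc m) × ∣ k ∣ ℕ.≤ suc m
    pronic (+ m) = m , trans (cong (λ j → + m * + j) (ℕₚ.+-comm m 1)) (sym (ℤₚ.pos-* m (suc m))) , ℕₚ.n≤1+n m
    pronic -[1+ m ] = m , trans (cong (-[1+ m ] *_) (lem m)) (trans (flip (+ suc m) (+ m)) (trans (sym (ℤₚ.pos-* (suc m) m)) (cong +_ (ℕₚ.*-comm (suc m) m)))) , ℕₚ.≤-refl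
      where
      lem : ∀ m → -[1+ m ] + 1ℤ ≡ - (+ m)
      lem zero    = refl
      lem (suc m) = refl
      flip : ∀ a b → (- a) * (- b) ≡ a * b
      flip = solve-∀

    K : ℕ
    -- For negative `k`, `∣ k ∣` exceeds by one the natural `m` with `m (m + 1) = k (k + 1)`, whence
    -- the `suc`.
    K = suc (2 ℕ.* n)

    bounds : ∀ x → InX x → ∣ proj₁ x ∣ ℕ.≤ K × ∣ proj₁ (proj₂ x) ∣ ℕ.≤ K × ∣ proj₂ (proj₂ x) ∣ ℕ.≤ K
    bounds (k , _ , _) (pos p , pos q , eq) with m , k≡ , k≤ ← pronic k =
      ℕₚ.≤-trans k≤ (ℕ.s≤s (ℕₚ.≤-trans (ℕₚ.m≤m*n m (suc m)) (ℕₚ.≤-trans (ℕₚ.m≤m+n _ _) (ℕₚ.≤-reflexive eqℕ)))) ,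
      ℕₚ.≤-trans (ℕₚ.m≤m*n (suc p) (suc q)) pq≤ ,
      ℕₚ.≤-trans (ℕₚ.m≤n*m (suc q) (suc p)) pq≤
      where
      eqℕ : m ℕ.* suc m ℕ.+ 2 ℕ.* (suc p ℕ.* suc q) ≡ 2 ℕ.* n
      eqℕ = ℤₚ.+-injective (trans (cong₂ _+_ (sym k≡) (ℤₚ.pos-* 2 (suc p ℕ.* suc q)))
              (trans eq (sym (ℤₚ.pos-* 2 n))))
      pq≤ : suc p ℕ.* suc q ℕ.≤ K
      pq≤ = ℕₚ.m≤n⇒m≤1+n (ℕₚ.≤-trans (ℕₚ.m≤n*m _ 2) (ℕₚ.≤-trans (ℕₚ.m≤n+m _ (m ℕ.* suc m)) (ℕₚ.≤-reflexive eqℕ)))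

  X : Enum InX
  X = restrict (ball K ⊗ ball K ⊗ ball K)
        (λ (k , d , e) → pos? d ×-dec pos? e ×-dec (k * (k + 1ℤ) + + 2 * (d * e) ℤₚ.≟ + 2 * + n))
        bounds

  -- `t` is half the value at (2 , 1) of the form with coefficients `d`, `u = 2k + 1`, `-2e`. In
  -- `weight` the part `2d` gives twice the wanted sum; the part `u` contributes zero in total, but
  -- makes `2d + u` invariant up to sign under the maps below.
  v t weight : ℤ³ → ℤ
  v (k , d , e) = d + (+ 2 * k + 1ℤ) - + 2 * e
  t (k , d , e) = + 2 * d + (+ 2 * k + 1ℤ) - e
  weight (k , d , e) = - ε d * (+ 2 * d + (+ 2 * k + 1ℤ))

  X⁺ : Enum (λ x → InX x × Pos (v x))
  X⁺ = X ∩ λ x → pos? (v x)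

  X⁻ : Enum (λ x → InX x × Pos (- v x))
  X⁻ = X ∩ λ x → pos? (- v x)

  -- With u = 2k + 1, X consists of the binary quadratic forms [d , u , −2e] of discriminant 8n + 1 with
  -- d > 0 > −2e, and v is the value at (1 , 1). reflect is the unipotent substitution fixing e, followed
  -- by u ↦ −u; swap exchanges d and −v; flip changes the sign of 2d + u and keeps both d and v.
  reflect swap flip : ℤ³ → ℤ³
  reflect (k , d , e) = + 2 * e - k - 1ℤ , d + (+ 2 * k + 1ℤ) - + 2 * e , e
  swap (k , d , e) = + 2 * d + + 3 * k + 1ℤ - + 2 * e , + 2 * e - d - (+ 2 * k + 1ℤ) , + 2 * d + (+ 2 * k + 1ℤ) - e
  flip (k , d , e) = - (+ 2 * d) - k - 1ℤ , d , e - + 2 * d - (+ 2 * k + 1ℤ)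

  triple-≡ : ∀ {k k′ d d′ e e′ : ℤ} → k ≡ k′ → d ≡ d′ → e ≡ e′ → (k , d , e) ≡ (k′ , d′ , e′)
  triple-≡ refl refl refl = refl

  odd-shift : ∀ d d′ {w w′} → ε d′ ≡ - ε d → w ≡ w′ → - ε d * w ≡ - (- ε d′ * w′)
  odd-shift d d′ {w} p refl = trans (cong (_* w) (sym p)) (double-neg (ε d′) w)
    where
    double-neg : ∀ a b → a * b ≡ - (- a * b)
    double-neg = solve-∀

  -- `reflect` exchanges `d` and `v`, whose parities differ because `2k + 1` is odd, and keeps
  -- `2d + (2k + 1)`.
  sum-X⁺ : ∑ᴱ X⁺ weight ≡ 0ℤ
  sum-X⁺ = ∑ᴱ-antisym X⁺ reflect
    (λ (k , d , e) ((d>0 , e>0 , eq) , v>0) →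
      (v>0 , e>0 , trans (form k d e) eq) , subst Pos (v-reflect k d e) d>0)
    (λ (k , d , e) _ → triple-≡ (back₁ k d e) (sym (v-reflect k d e)) refl)
    (λ (k , d , e) _ → odd-shift d (proj₁ (proj₂ (reflect (k , d , e))))
      (trans (cong ε (shape k d e)) (trans (ε-+double (1ℤ + d) (k - e)) (ε-suc d)))
      (linear k d e))
    where
    form : ∀ k d e → (+ 2 * e - k - 1ℤ) * (+ 2 * e - k - 1ℤ + 1ℤ) + + 2 * ((d + (+ 2 * k + 1ℤ) - + 2 * e) * e)
                   ≡ k * (k + 1ℤ) + + 2 * (d * e)
    form = solve-∀
    v-reflect : ∀ k d e → d ≡ d + (+ 2 * k + 1ℤ) - + 2 * e + (+ 2 * (+ 2 * e - k - 1ℤ) + 1ℤ) - + 2 * e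
    v-reflect = solve-∀
    back₁ : ∀ k d e → + 2 * e - (+ 2 * e - k - 1ℤ) - 1ℤ ≡ k
    back₁ = solve-∀
    shape : ∀ k d e → d + (+ 2 * k + 1ℤ) - + 2 * e ≡ 1ℤ + d + ((k - e) + (k - e))
    shape = solve-∀
    linear : ∀ k d e → + 2 * d + (+ 2 * k + 1ℤ)
             ≡ + 2 * (d + (+ 2 * k + 1ℤ) - + 2 * e) + (+ 2 * (+ 2 * e - k - 1ℤ) + 1ℤ)
    linear = solve-∀

  X⁻⁺ : Enum (λ x → (InX x × Pos (- v x)) × Pos (t x))
  X⁻⁺ = X⁻ ∩ λ x → pos? (t x)

  X⁻⁻ : Enum (λ x → (InX x × Pos (- v x)) × Pos (- t x))
  X⁻⁻ = X⁻ ∩ λ x → pos? (- t x)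

  -- `swap` exchanges `d` with `-v` and also `e` with `t`, so all four sign conditions are carried
  -- along. Again the parity of `d` changes and `2d + (2k + 1)` stays.
  sum-X⁻⁺ : ∑ᴱ X⁻⁺ weight ≡ 0ℤ
  sum-X⁻⁺ = ∑ᴱ-antisym X⁻⁺ swap
    (λ (k , d , e) (((d>0 , e>0 , eq) , v<0) , t>0) →
      ((subst Pos (d-swap k d e) v<0 , t>0 , trans (form k d e) eq)
        , subst Pos (v-swap k d e) d>0) , subst Pos (t-swap k d e) e>0)
    (λ (k , d , e) _ → triple-≡ (k-back k d e) (d-back k d e) (e-back k d e))
    (λ (k , d , e) _ → odd-shift d (proj₁ (proj₂ (swap (k , d , e))))
      (trans (cong ε (shape k d e)) (trans (ε-+double (1ℤ + - d) (e - k - 1ℤ)) (trans (ε-suc (- d)) (cong -_ (ε-neg d)))))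
      (linear k d e))
    where
    form : ∀ k d e → (+ 2 * d + + 3 * k + 1ℤ - + 2 * e) * (+ 2 * d + + 3 * k + 1ℤ - + 2 * e + 1ℤ)
                     + + 2 * ((+ 2 * e - d - (+ 2 * k + 1ℤ)) * (+ 2 * d + (+ 2 * k + 1ℤ) - e))
                   ≡ k * (k + 1ℤ) + + 2 * (d * e)
    form = solve-∀
    d-swap : ∀ k d e → - (d + (+ 2 * k + 1ℤ) - + 2 * e) ≡ + 2 * e - d - (+ 2 * k + 1ℤ)
    d-swap = solve-∀
    v-swap : ∀ k d e → d ≡ - (+ 2 * e - d - (+ 2 * k + 1ℤ) + (+ 2 * (+ 2 * d + + 3 * k + 1ℤ - + 2 * e) + 1ℤ)
                              - + 2 * (+ 2 * d + (+ 2 * k + 1ℤ) - e))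
    v-swap = solve-∀
    t-swap : ∀ k d e → e ≡ + 2 * (+ 2 * e - d - (+ 2 * k + 1ℤ)) + (+ 2 * (+ 2 * d + + 3 * k + 1ℤ - + 2 * e) + 1ℤ)
                           - (+ 2 * d + (+ 2 * k + 1ℤ) - e)
    t-swap = solve-∀
    k-back : ∀ k d e → + 2 * (+ 2 * e - d - (+ 2 * k + 1ℤ)) + + 3 * (+ 2 * d + + 3 * k + 1ℤ - + 2 * e) + 1ℤ
                       - + 2 * (+ 2 * d + (+ 2 * k + 1ℤ) - e) ≡ k
    k-back = solve-∀
    d-back : ∀ k d e → + 2 * (+ 2 * d + (+ 2 * k + 1ℤ) - e) - (+ 2 * e - d - (+ 2 * k + 1ℤ))
                       - (+ 2 * (+ 2 * d + + 3 * k + 1ℤ - + 2 * e) + 1ℤ) ≡ d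
    d-back = solve-∀
    e-back : ∀ k d e → + 2 * (+ 2 * e - d - (+ 2 * k + 1ℤ)) + (+ 2 * (+ 2 * d + + 3 * k + 1ℤ - + 2 * e) + 1ℤ)
                           - (+ 2 * d + (+ 2 * k + 1ℤ) - e) ≡ e
    e-back = solve-∀
    shape : ∀ k d e → + 2 * e - d - (+ 2 * k + 1ℤ) ≡ 1ℤ + - d + ((e - k - 1ℤ) + (e - k - 1ℤ))
    shape = solve-∀
    linear : ∀ k d e → + 2 * d + (+ 2 * k + 1ℤ)
             ≡ + 2 * (+ 2 * e - d - (+ 2 * k + 1ℤ)) + (+ 2 * (+ 2 * d + + 3 * k + 1ℤ - + 2 * e) + 1ℤ)
    linear = solve-∀

  -- Here `e` is exchanged with `-t`. The sign `ε d` stays, and it is the linear factor that is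
  -- negated.
  sum-X⁻⁻ : ∑ᴱ X⁻⁻ weight ≡ 0ℤ
  sum-X⁻⁻ = ∑ᴱ-antisym X⁻⁻ flip
    (λ (k , d , e) (((d>0 , e>0 , eq) , v<0) , t<0) →
      ((d>0 , subst Pos (e-flip k d e) t<0 , trans (form k d e) eq)
        , subst Pos (v-flip k d e) v<0) , subst Pos (t-flip k d e) e>0)
    (λ (k , d , e) _ → triple-≡ (k-back k d) refl (e-back k d e))
    (λ (k , d , e) _ → negate k d (- ε d))
    where
    form : ∀ k d e → (- (+ 2 * d) - k - 1ℤ) * (- (+ 2 * d) - k - 1ℤ + 1ℤ) + + 2 * (d * (e - + 2 * d - (+ 2 * k + 1ℤ)))
                   ≡ k * (k + 1ℤ) + + 2 * (d * e)
    form = solve-∀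
    e-flip : ∀ k d e → - (+ 2 * d + (+ 2 * k + 1ℤ) - e) ≡ e - + 2 * d - (+ 2 * k + 1ℤ)
    e-flip = solve-∀
    v-flip : ∀ k d e → - (d + (+ 2 * k + 1ℤ) - + 2 * e)
             ≡ - (d + (+ 2 * (- (+ 2 * d) - k - 1ℤ) + 1ℤ) - + 2 * (e - + 2 * d - (+ 2 * k + 1ℤ)))
    v-flip = solve-∀
    t-flip : ∀ k d e → e ≡ - (+ 2 * d + (+ 2 * (- (+ 2 * d) - k - 1ℤ) + 1ℤ) - (e - + 2 * d - (+ 2 * k + 1ℤ)))
    t-flip = solve-∀
    k-back : ∀ k d → - (+ 2 * d) - (- (+ 2 * d) - k - 1ℤ) - 1ℤ ≡ k
    k-back = solve-∀
    e-back : ∀ k d e → e - + 2 * d - (+ 2 * k + 1ℤ) - + 2 * d - (+ 2 * (- (+ 2 * d) - k - 1ℤ) + 1ℤ) ≡ e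
    e-back = solve-∀
    negate : ∀ k d s → s * (+ 2 * d + (+ 2 * k + 1ℤ)) ≡ - (s * (+ 2 * d + (+ 2 * (- (+ 2 * d) - k - 1ℤ) + 1ℤ)))
    negate = solve-∀

-- The boundary regions, where the discriminant is a square

<⇒∃ : ∀ {i r} → i ℕ.< r → ∃ λ m → r ≡ suc i ℕ.+ m
<⇒∃ {i} {r} i<r = let m , eq = ℕₚ.m≤n⇒∃[o]m+o≡n i<r in m , sym eq

∑-const : ∀ {A : Set} (c : ℤ) r → ∑ (downFrom r) (λ _ → c) ≡ + r * c
∑-const c zero    = sym (ℤₚ.*-zeroˡ c)
∑-const {A} c (suc r) = trans (cong (λ s → c + s) (∑-const {A} c r)) (step c (+ r))
  where
  step : ∀ c r → c + r * c ≡ (1ℤ + r) * c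
  step = solve-∀

-- Telescoping: `(-1)^m (2m + 1)` is the increment at `m` of `-(-1)^m m`.
alternating-odds : ∀ r → ∑ (downFrom r) (λ m → ε (+ m) * (+ 2 * + m + 1ℤ)) ≡ - (ε (+ r) * + r)
alternating-odds zero    = refl
alternating-odds (suc r) = trans (cong (λ s → ε (+ r) * (+ 2 * + r + 1ℤ) + s) (alternating-odds r))
                                 (step (ε (+ r)) (+ r))
  where
  step : ∀ x r → x * (+ 2 * r + 1ℤ) + - (x * r) ≡ - (- x * (1ℤ + r))
  step = solve-∀

module _ (n : ℕ) where

  -- There is at most one such `r`. Summing over this set treats triangular and non-triangular `n`
  -- alike, without a case distinction.
  Pronic : Enum (λ r → r ℕ.* suc r ≡ 2 ℕ.* n)
  Pronic = restrict (below (suc (2 ℕ.* n))) (λ r → r ℕ.* suc r ℕ.≟ 2 ℕ.* n)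
        λ r eq → ℕ.s≤s (ℕₚ.≤-trans (ℕₚ.m≤m*n r (suc r)) (ℕₚ.≤-reflexive eq))

  private
    PronicBelow : Enum (λ ri → (proj₁ ri ℕ.* suc (proj₁ ri) ≡ 2 ℕ.* n) × proj₂ ri ℕ.< proj₁ ri)
    PronicBelow = Pronic ▹ below

    root-eq : ∀ r {z : ℤ} → z ≡ + r * (+ r + 1ℤ) → z ≡ + 2 * + n → r ℕ.* suc r ≡ 2 ℕ.* n
    root-eq r p q = ℤₚ.+-injective (trans (ℤₚ.pos-* r (suc r))
      (trans (cong (+ r *_) (ℤₚ.+-comm 1ℤ (+ r))) (trans (trans (sym p) q) (sym (ℤₚ.pos-* 2 n)))))

    root-eq⁻ : ∀ r {z : ℤ} → z ≡ + r * (+ r + 1ℤ) → r ℕ.* suc r ≡ 2 ℕ.* n → z ≡ + 2 * + n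
    root-eq⁻ r p q = trans p (trans (cong (+ r *_) (ℤₚ.+-comm (+ r) 1ℤ))
      (trans (sym (ℤₚ.pos-* r (suc r))) (trans (cong +_ q) (ℤₚ.pos-* 2 n))))

    Pos-2m+1 : ∀ m → Pos (+ 2 * + m + 1ℤ)
    Pos-2m+1 m = subst Pos (cong (_+ 1ℤ) (ℤₚ.pos-* 2 m)) (subst Pos (ℤₚ.+-comm 1ℤ (+ (2 ℕ.* m))) (pos (2 ℕ.* m)))

    X⁰ : Enum (λ x → InX n x × v n x ≡ 0ℤ)
    X⁰ = X n ∩ λ x → zero? (v n x)

    X⁻⁰ : Enum (λ x → (InX n x × Pos (- v n x)) × t n x ≡ 0ℤ)
    X⁻⁰ = X⁻ n ∩ λ x → zero? (t n x)

    -- On `v = 0` the entry `d = 2e - (2k + 1)` is odd. With `e = q + 1` and `d = 2m + 1` the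
    -- equation becomes `r (r + 1) = 2n` for `r = e + m`; so `n` fixes `r`, and `q` runs over the
    -- naturals below `r`.
    p₀ : ℕ → ℕ → ℤ³
    p₀ q m = + suc q - + m - 1ℤ , + 2 * + m + 1ℤ , + suc q

    form₀ : ∀ e m → (e - m - 1ℤ) * (e - m - 1ℤ + 1ℤ) + + 2 * ((+ 2 * m + 1ℤ) * e) ≡ (e + m) * (e + m + 1ℤ)
    form₀ = solve-∀

    view₀ : ∀ x → InX n x → v n x ≡ 0ℤ → ∃₂ λ q m → x ≡ p₀ q m
    view₀ (k , d , e) (d>0 , pos q , _) v≡0 =
      let m , m≡ = Pos-odd⇒ℕ (+ suc q - k - 1ℤ) (subst Pos d≡ d>0)
      in q , m , triple-≡ n (trans (k≡ (+ suc q) k) (cong (λ j → + suc q - j - 1ℤ) m≡))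
                   (trans d≡ (cong (λ j → + 2 * j + 1ℤ) m≡)) refl
      where
      solve-d : ∀ d k e → d ≡ (d + (+ 2 * k + 1ℤ) - + 2 * e) + (+ 2 * (e - k - 1ℤ) + 1ℤ)
      solve-d = solve-∀
      d≡ : d ≡ + 2 * (+ suc q - k - 1ℤ) + 1ℤ
      d≡ = trans (solve-d d k (+ suc q)) (trans (cong (λ z → z + (+ 2 * (+ suc q - k - 1ℤ) + 1ℤ)) v≡0) (ℤₚ.+-identityˡ _))
      k≡ : ∀ e k → k ≡ e - (e - k - 1ℤ) - 1ℤ
      k≡ = solve-∀

    φ₀ : ℤ³ → ℕ × ℕ
    φ₀ (k , d , e) = ∣ + 2 * e - k - 1ℤ ∣ , ℕ.pred ∣ e ∣

    ψ₀ : ℕ × ℕ → ℤ³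
    ψ₀ (r , i) = + 2 * + suc i - + r - 1ℤ , + 2 * (+ r - + suc i) + 1ℤ , + suc i

    φ₀-p₀ : ∀ q m → φ₀ (p₀ q m) ≡ (suc q ℕ.+ m , q)
    φ₀-p₀ q m = cong (_, q) (cong ∣_∣ (lem (+ suc q) (+ m)))
      where
      lem : ∀ e m → + 2 * e - (e - m - 1ℤ) - 1ℤ ≡ e + m
      lem = solve-∀

    ψ₀-p₀ : ∀ q m → ψ₀ (suc q ℕ.+ m , q) ≡ p₀ q m
    ψ₀-p₀ q m = triple-≡ n (lem₁ (+ suc q) (+ m)) (cong (λ z → + 2 * z + 1ℤ) (lem₂ (+ suc q) (+ m))) refl
      where
      lem₁ : ∀ e m → + 2 * e - (e + m) - 1ℤ ≡ e - m - 1ℤ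
      lem₁ = solve-∀
      lem₂ : ∀ e m → e + m - e ≡ m
      lem₂ = solve-∀

    -- Since `d` is odd the sign is `+1`, and `2d + (2k + 1)` equals `2r + 1` at every point of the
    -- region.
    sum-X⁰ : ∑ᴱ X⁰ (weight n) ≡ ∑ᴱ PronicBelow (λ (r , _) → + 2 * + r + 1ℤ)
    sum-X⁰ = reindex X⁰ PronicBelow φ₀ ψ₀ to from ψφ φψ same
      where
      to : ∀ x → InX n x × v n x ≡ 0ℤ → _
      to x (inX@(_ , _ , eq) , v≡0) with q , m , refl ← view₀ x inX v≡0 =
        subst (λ (r , i) → (r ℕ.* suc r ≡ 2 ℕ.* n) × i ℕ.< r) (sym (φ₀-p₀ q m))
          (root-eq (suc q ℕ.+ m) (form₀ (+ suc q) (+ m)) eq , ℕₚ.m≤m+n (suc q) m)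
      from : ∀ ri → (proj₁ ri ℕ.* suc (proj₁ ri) ≡ 2 ℕ.* n) × proj₂ ri ℕ.< proj₁ ri → InX n (ψ₀ ri) × v n (ψ₀ ri) ≡ 0ℤ
      from (r , i) (eq , i<r) with m , refl ← <⇒∃ i<r =
        subst (λ x → InX n x × v n x ≡ 0ℤ) (sym (ψ₀-p₀ i m))
          ((Pos-2m+1 m , pos i , root-eq⁻ (suc i ℕ.+ m) (form₀ (+ suc i) (+ m)) eq) , v-p₀ (+ suc i) (+ m))
        where
        v-p₀ : ∀ e m → + 2 * m + 1ℤ + (+ 2 * (e - m - 1ℤ) + 1ℤ) - + 2 * e ≡ 0ℤ
        v-p₀ = solve-∀
      ψφ : ∀ x → InX n x × v n x ≡ 0ℤ → ψ₀ (φ₀ x) ≡ x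
      ψφ x (inX , v≡0) with q , m , refl ← view₀ x inX v≡0 = trans (cong ψ₀ (φ₀-p₀ q m)) (ψ₀-p₀ q m)
      φψ : ∀ ri → (proj₁ ri ℕ.* suc (proj₁ ri) ≡ 2 ℕ.* n) × proj₂ ri ℕ.< proj₁ ri → φ₀ (ψ₀ ri) ≡ ri
      φψ (r , i) (_ , i<r) with m , refl ← <⇒∃ i<r = trans (cong φ₀ (ψ₀-p₀ i m)) (φ₀-p₀ i m)
      same : ∀ x → InX n x × v n x ≡ 0ℤ → weight n x ≡ + 2 * + proj₁ (φ₀ x) + 1ℤ
      same x (inX , v≡0) with q , m , refl ← view₀ x inX v≡0 = begin
        - ε (+ 2 * + m + 1ℤ) * w     ≡⟨ cong (λ s → - s * w) (trans (cong ε (double (+ m))) (ε-odd (+ m))) ⟩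
        1ℤ * w                       ≡⟨ linear (+ suc q) (+ m) ⟩
        + 2 * + (suc q ℕ.+ m) + 1ℤ   ≡⟨ cong (λ ri → + 2 * + proj₁ ri + 1ℤ) (φ₀-p₀ q m) ⟨
        _ ∎
        where
        open ≡-Reasoning
        w : ℤ
        w = + 2 * (+ 2 * + m + 1ℤ) + (+ 2 * (+ suc q - + m - 1ℤ) + 1ℤ)
        double : ∀ m → + 2 * m + 1ℤ ≡ 1ℤ + (m + m)
        double = solve-∀
        linear : ∀ e m → 1ℤ * (+ 2 * (+ 2 * m + 1ℤ) + (+ 2 * (e - m - 1ℤ) + 1ℤ)) ≡ + 2 * (e + m) + 1ℤ
        linear = solve-∀

    -- On `t = 0` the entry `e = 2d + (2k + 1)` is odd. With `d = p + 1` and `e = 2m + 1` the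
    -- equation is again `r (r + 1) = 2n`, now for `r = d + m`; moreover `-v = d + e`, which gives
    -- the sign of `v`.
    p₁ : ℕ → ℕ → ℤ³
    p₁ p m = + m - + suc p , + suc p , + 2 * + m + 1ℤ

    form₁ : ∀ d m → (m - d) * (m - d + 1ℤ) + + 2 * (d * (+ 2 * m + 1ℤ)) ≡ (d + m) * (d + m + 1ℤ)
    form₁ = solve-∀

    view₁ : ∀ x → InX n x → t n x ≡ 0ℤ → ∃₂ λ p m → x ≡ p₁ p m
    view₁ (k , d , e) (pos p , e>0 , _) t≡0 =
      let m , m≡ = Pos-odd⇒ℕ (+ suc p + k) (subst Pos e≡ e>0)
      in p , m , triple-≡ n (trans (k≡ (+ suc p) k) (cong (λ j → j - + suc p) m≡))
                   refl (trans e≡ (cong (λ j → + 2 * j + 1ℤ) m≡))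
      where
      solve-e : ∀ d k → + 2 * d + (+ 2 * k + 1ℤ) ≡ + 2 * (d + k) + 1ℤ
      solve-e = solve-∀
      e≡ : e ≡ + 2 * (+ suc p + k) + 1ℤ
      e≡ = trans (sym (ℤₚ.i-j≡0⇒i≡j _ _ t≡0)) (solve-e (+ suc p) k)
      k≡ : ∀ d k → k ≡ d + k - d
      k≡ = solve-∀

    φ₁ : ℤ³ → ℕ × ℕ
    φ₁ (k , d , e) = ∣ + 2 * d + k ∣ , ∣ d + k ∣

    ψ₁ : ℕ × ℕ → ℤ³
    ψ₁ (r , m) = + 2 * + m - + r , + r - + m , + 2 * + m + 1ℤ

    φ₁-p₁ : ∀ p m → φ₁ (p₁ p m) ≡ (suc p ℕ.+ m , m)
    φ₁-p₁ p m = cong₂ _,_ (cong ∣_∣ (lem₁ (+ suc p) (+ m))) (cong ∣_∣ (lem₂ (+ suc p) (+ m)))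
      where
      lem₁ : ∀ d m → + 2 * d + (m - d) ≡ d + m
      lem₁ = solve-∀
      lem₂ : ∀ d m → d + (m - d) ≡ m
      lem₂ = solve-∀

    ψ₁-p₁ : ∀ p m → ψ₁ (suc p ℕ.+ m , m) ≡ p₁ p m
    ψ₁-p₁ p m = triple-≡ n (lem₁ (+ suc p) (+ m)) (lem₂ (+ suc p) (+ m)) refl
      where
      lem₁ : ∀ d m → + 2 * m - (d + m) ≡ m - d
      lem₁ = solve-∀
      lem₂ : ∀ d m → d + m - m ≡ d
      lem₂ = solve-∀

    <⇒∃ʳ : ∀ {m r} → m ℕ.< r → ∃ λ p → r ≡ suc p ℕ.+ m
    <⇒∃ʳ {m} m<r = let p , eq = <⇒∃ m<r in p , trans eq (cong suc (ℕₚ.+-comm m p))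

    -- The weight is `-ε d` times `e = 2m + 1`, and `r = d + m` gives `ε d = ε r · ε m`. For fixed
    -- `r` this is an alternating sum of odd numbers.
    sum-X⁻⁰ : ∑ᴱ X⁻⁰ (weight n) ≡ ∑ᴱ PronicBelow (λ (r , m) → - ε (+ r) * (ε (+ m) * (+ 2 * + m + 1ℤ)))
    sum-X⁻⁰ = reindex X⁻⁰ PronicBelow φ₁ ψ₁ to from ψφ φψ same
      where
      to : ∀ x → (InX n x × Pos (- v n x)) × t n x ≡ 0ℤ → _
      to x ((inX@(_ , _ , eq) , _) , t≡0) with p , m , refl ← view₁ x inX t≡0 =
        subst (λ (r , i) → (r ℕ.* suc r ≡ 2 ℕ.* n) × i ℕ.< r) (sym (φ₁-p₁ p m))
          (root-eq (suc p ℕ.+ m) (form₁ (+ suc p) (+ m)) eq , ℕ.s≤s (ℕₚ.m≤n+m m p))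
      from : ∀ ri → (proj₁ ri ℕ.* suc (proj₁ ri) ≡ 2 ℕ.* n) × proj₂ ri ℕ.< proj₁ ri →
             (InX n (ψ₁ ri) × Pos (- v n (ψ₁ ri))) × t n (ψ₁ ri) ≡ 0ℤ
      from (r , m) (eq , m<r) with p , refl ← <⇒∃ʳ m<r =
        subst (λ x → (InX n x × Pos (- v n x)) × t n x ≡ 0ℤ) (sym (ψ₁-p₁ p m))
          (((pos p , Pos-2m+1 m , root-eq⁻ (suc p ℕ.+ m) (form₁ (+ suc p) (+ m)) eq)
            , subst Pos (v-p₁ (+ suc p) (+ m)) (Pos-+ (pos p) (Pos-2m+1 m))) , t-p₁ (+ suc p) (+ m))
        where
        v-p₁ : ∀ d m → d + (+ 2 * m + 1ℤ) ≡ - (d + (+ 2 * (m - d) + 1ℤ) - + 2 * (+ 2 * m + 1ℤ))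
        v-p₁ = solve-∀
        t-p₁ : ∀ d m → + 2 * d + (+ 2 * (m - d) + 1ℤ) - (+ 2 * m + 1ℤ) ≡ 0ℤ
        t-p₁ = solve-∀
      ψφ : ∀ x → (InX n x × Pos (- v n x)) × t n x ≡ 0ℤ → ψ₁ (φ₁ x) ≡ x
      ψφ x ((inX , _) , t≡0) with p , m , refl ← view₁ x inX t≡0 = trans (cong ψ₁ (φ₁-p₁ p m)) (ψ₁-p₁ p m)
      φψ : ∀ ri → (proj₁ ri ℕ.* suc (proj₁ ri) ≡ 2 ℕ.* n) × proj₂ ri ℕ.< proj₁ ri → φ₁ (ψ₁ ri) ≡ ri
      φψ (r , m) (_ , m<r) with p , refl ← <⇒∃ʳ m<r = trans (cong φ₁ (ψ₁-p₁ p m)) (φ₁-p₁ p m)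
      same : ∀ x → (InX n x × Pos (- v n x)) × t n x ≡ 0ℤ →
             weight n x ≡ - ε (+ proj₁ (φ₁ x)) * (ε (+ proj₂ (φ₁ x)) * (+ 2 * + proj₂ (φ₁ x) + 1ℤ))
      same x ((inX , _) , t≡0) with p , m , refl ← view₁ x inX t≡0 = begin
        - ε (+ suc p) * (+ 2 * + suc p + (+ 2 * (+ m - + suc p) + 1ℤ))
          ≡⟨ cong (- ε (+ suc p) *_) (linear (+ suc p) (+ m)) ⟩
        - ε (+ suc p) * (+ 2 * + m + 1ℤ)
          ≡⟨ cong (λ s → - s * (+ 2 * + m + 1ℤ)) ε-split ⟩
        - (ε (+ (suc p ℕ.+ m)) * ε (+ m)) * (+ 2 * + m + 1ℤ)
          ≡⟨ assoc (ε (+ (suc p ℕ.+ m))) (ε (+ m)) (+ 2 * + m + 1ℤ) ⟩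
        - ε (+ (suc p ℕ.+ m)) * (ε (+ m) * (+ 2 * + m + 1ℤ))
          ≡⟨ cong (λ ri → - ε (+ proj₁ ri) * (ε (+ proj₂ ri) * (+ 2 * + proj₂ ri + 1ℤ))) (φ₁-p₁ p m) ⟨
        _ ∎
        where
        open ≡-Reasoning
        linear : ∀ d m → + 2 * d + (+ 2 * (m - d) + 1ℤ) ≡ + 2 * m + 1ℤ
        linear = solve-∀
        assoc : ∀ a b c → - (a * b) * c ≡ - a * (b * c)
        assoc = solve-∀
        ε-split : ε (+ suc p) ≡ ε (+ (suc p ℕ.+ m)) * ε (+ m)
        ε-split = trans (sym (ε-+double (+ suc p) (+ m)))
          (trans (cong ε (sym (ℤₚ.+-assoc (+ suc p) (+ m) (+ m)))) (ε-+ (+ (suc p ℕ.+ m)) (+ m)))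

  -- The regions v = 0 and t = 0 > v are not covered by the involutions: they are
  -- nonempty only when 8n + 1 = (2r + 1)², i.e. when n is triangular.
  sum-X : ∑ᴱ (X n) (weight n) ≡ ∑ᴱ Pronic (λ _ → + 4 * + n)
  sum-X = begin
    ∑ᴱ (X n) (weight n)
      ≡⟨ split-sign (X n) (v n) (weight n) ⟩
    ∑ᴱ (X⁺ n) (weight n) + (∑ᴱ X⁰ (weight n) + ∑ᴱ (X⁻ n) (weight n))
      ≡⟨ cong₂ (λ a b → a + (∑ᴱ X⁰ (weight n) + b)) (sum-X⁺ n) (split-sign (X⁻ n) (t n) (weight n)) ⟩
    0ℤ + (∑ᴱ X⁰ (weight n) + (∑ᴱ (X⁻⁺ n) (weight n) + (∑ᴱ X⁻⁰ (weight n) + ∑ᴱ (X⁻⁻ n) (weight n))))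
      ≡⟨ cong₂ (λ a b → 0ℤ + (∑ᴱ X⁰ (weight n) + (a + (∑ᴱ X⁻⁰ (weight n) + b)))) (sum-X⁻⁺ n) (sum-X⁻⁻ n) ⟩
    0ℤ + (∑ᴱ X⁰ (weight n) + (0ℤ + (∑ᴱ X⁻⁰ (weight n) + 0ℤ)))
      ≡⟨ tidy (∑ᴱ X⁰ (weight n)) (∑ᴱ X⁻⁰ (weight n)) ⟩
    ∑ᴱ X⁰ (weight n) + ∑ᴱ X⁻⁰ (weight n)
      ≡⟨ cong₂ _+_ (trans sum-X⁰ (∑-▹ Pronic below _)) (trans sum-X⁻⁰ (∑-▹ Pronic below _)) ⟩
    ∑ᴱ Pronic (λ r → ∑ (downFrom r) λ _ → + 2 * + r + 1ℤ)
      + ∑ᴱ Pronic (λ r → ∑ (downFrom r) λ m → - ε (+ r) * (ε (+ m) * (+ 2 * + m + 1ℤ)))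
      ≡⟨ ∑-+ _ _ (list Pronic) ⟨
    ∑ᴱ Pronic (λ r → ∑ (downFrom r) (λ _ → + 2 * + r + 1ℤ) + ∑ (downFrom r) λ m → - ε (+ r) * (ε (+ m) * (+ 2 * + m + 1ℤ)))
      ≡⟨ ∑ᴱ-cong Pronic inner ⟩
    ∑ᴱ Pronic (λ _ → + 4 * + n) ∎
    where
    open ≡-Reasoning
    tidy : ∀ a b → 0ℤ + (a + (0ℤ + (b + 0ℤ))) ≡ a + b
    tidy = solve-∀
    inner : ∀ r → r ℕ.* suc r ≡ 2 ℕ.* n →
            ∑ (downFrom r) (λ _ → + 2 * + r + 1ℤ) + ∑ (downFrom r) (λ m → - ε (+ r) * (ε (+ m) * (+ 2 * + m + 1ℤ)))
            ≡ + 4 * + n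
    -- The two regions contribute `r (2r + 1)` and `r`, together `2 r (r + 1) = 4n`.
    inner r eq = begin
      ∑ (downFrom r) (λ _ → + 2 * + r + 1ℤ) + ∑ (downFrom r) (λ m → - ε (+ r) * (ε (+ m) * (+ 2 * + m + 1ℤ)))
        ≡⟨ cong₂ _+_ (∑-const {ℕ} (+ 2 * + r + 1ℤ) r)
             (trans (∑-*ˡ (- ε (+ r)) _ (downFrom r)) (cong (- ε (+ r) *_) (alternating-odds r))) ⟩
      + r * (+ 2 * + r + 1ℤ) + - ε (+ r) * - (ε (+ r) * + r)
        ≡⟨ cong (λ s → + r * (+ 2 * + r + 1ℤ) + s) (signs (ε (+ r)) (+ r)) ⟩
      + r * (+ 2 * + r + 1ℤ) + ε (+ r) * ε (+ r) * + r
        ≡⟨ cong (λ s → + r * (+ 2 * + r + 1ℤ) + s * + r) (trans (sym (ε-+ (+ r) (+ r))) (ε-double (+ r))) ⟩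
      + r * (+ 2 * + r + 1ℤ) + 1ℤ * + r
        ≡⟨ total (+ r) ⟩
      + 2 * (+ r * (+ r + 1ℤ))
        ≡⟨ cong (+ 2 *_) (root-eq⁻ r refl eq) ⟩
      + 2 * (+ 2 * + n)
        ≡⟨ ℤₚ.*-assoc (+ 2) (+ 2) (+ n) ⟨
      + 4 * + n ∎
      where
      signs : ∀ s r → - s * - (s * r) ≡ s * s * r
      signs = solve-∀
      total : ∀ r → r * (+ 2 * r + 1ℤ) + 1ℤ * r ≡ + 2 * (r * (r + 1ℤ))
      total = solve-∀

-- Divisor pairs and the coefficient identity for `ψ`

D-cond : ℕ → ℕ → ℤ × ℤ → Set
D-cond n x (d , e) = Pos d × Pos e × + x + d * e ≡ + n

D : ∀ n x → Enum (D-cond n x)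
D n x = restrict (ball n ⊗ ball n)
  (λ (d , e) → pos? d ×-dec pos? e ×-dec (+ x + d * e ℤₚ.≟ + n)) bounds
  where
  bounds : ∀ de → D-cond n x de → ∣ proj₁ de ∣ ℕ.≤ n × ∣ proj₂ de ∣ ℕ.≤ n
  bounds _ (pos p , pos q , eq) =
    ℕₚ.≤-trans (ℕₚ.m≤m*n (suc p) (suc q)) pq≤ , ℕₚ.≤-trans (ℕₚ.m≤n*m (suc q) (suc p)) pq≤
    where
    pq≤ : suc p ℕ.* suc q ℕ.≤ n
    pq≤ = ℕₚ.≤-trans (ℕₚ.m≤n+m _ x) (ℕₚ.≤-reflexive (ℤₚ.+-injective eq))

signed : ℤ × ℤ → ℤ
signed (d , _) = - ε d * d

-- This is `A(n - x)`. The condition `x + d e = n` avoids truncated subtraction and has no solutions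
-- when `x ≥ n`.
altσ : ℕ → ℕ → ℤ
altσ n x = ∑ᴱ (D n x) signed

k*suc-k : ∀ k → + k * (+ k + 1ℤ) ≡ + 2 * + tri k
k*suc-k k = trans (cong (λ j → + k * + j) (ℕₚ.+-comm k 1))
  (trans (sym (ℤₚ.pos-* k (suc k))) (trans (cong +_ (sym (2*tri k))) (ℤₚ.pos-* 2 (tri k))))

module _ (n : ℕ) where

  private
    f : ℤ³ → ℤ
    f (_ , de) = signed de

    mirror : ℤ³ → ℤ³
    mirror (k , de) = - k - 1ℤ , de

    mirror-ok : ∀ x → InX n x → InX n (mirror x)
    mirror-ok (k , d , e) (d>0 , e>0 , eq) = d>0 , e>0 , trans (cong (_+ + 2 * (d * e)) (form k)) eq
      where
      form : ∀ k → (- k - 1ℤ) * (- k - 1ℤ + 1ℤ) ≡ k * (k + 1ℤ)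
      form = solve-∀

    mirror² : ∀ x → mirror (mirror x) ≡ x
    mirror² (k , de) = cong (_, de) (twice k)
      where
      twice : ∀ k → - (- k - 1ℤ) - 1ℤ ≡ k
      twice = solve-∀

    odd-part : ∑ᴱ (X n) (λ (k , d , _) → - ε d * (+ 2 * k + 1ℤ)) ≡ 0ℤ
    odd-part = ∑ᴱ-antisym (X n) mirror mirror-ok (λ x _ → mirror² x) λ (k , d , _) _ → anti k (- ε d)
      where
      anti : ∀ k s → s * (+ 2 * k + 1ℤ) ≡ - (s * (+ 2 * (- k - 1ℤ) + 1ℤ))
      anti = solve-∀

    nonneg? : Decidable {A = ℤ³} (λ x → Pos (proj₁ x + 1ℤ))
    nonneg? x = pos? (proj₁ x + 1ℤ)

    X≥0 : Enum (λ x → InX n x × Pos (proj₁ x + 1ℤ))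
    X≥0 = X n ∩ nonneg?

    X<0 : Enum (λ x → InX n x × ¬ Pos (proj₁ x + 1ℤ))
    X<0 = X n ∩ λ x → ¬? (nonneg? x)

    mirror-sign : ∀ k → Pos (k + 1ℤ) → ¬ Pos (- k - 1ℤ + 1ℤ)
    mirror-sign k p = subst (λ z → ¬ Pos z) (shape k) (not-both k p)
      where
      shape : ∀ k → - k ≡ - k - 1ℤ + 1ℤ
      shape = solve-∀
      not-both : ∀ k → Pos (k + 1ℤ) → ¬ Pos (- k)
      not-both (+ zero)      _ ()
      not-both (+ suc _)     _ ()
      not-both -[1+ zero ]   ()
      not-both -[1+ suc _ ]  ()

    mirror-sign⁻ : ∀ k → ¬ Pos (k + 1ℤ) → Pos (- k - 1ℤ + 1ℤ)
    mirror-sign⁻ k ¬p = subst Pos (shape k) (one-of k ¬p)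
      where
      shape : ∀ k → - k ≡ - k - 1ℤ + 1ℤ
      shape = solve-∀
      one-of : ∀ k → ¬ Pos (k + 1ℤ) → Pos (- k)
      one-of (+ k)    ¬p = ⊥-elim (¬p (subst Pos (ℤₚ.+-comm 1ℤ (+ k)) (pos k)))
      one-of -[1+ k ] _  = pos k

    X<0≡X≥0 : ∑ᴱ X≥0 f ≡ ∑ᴱ X<0 f
    X<0≡X≥0 = reindex X≥0 X<0 mirror mirror
      (λ x (inX , p) → mirror-ok x inX , mirror-sign (proj₁ x) p)
      (λ x (inX , p) → mirror-ok x inX , mirror-sign⁻ (proj₁ x) p)
      (λ x _ → mirror² x) (λ x _ → mirror² x) (λ _ _ → refl)

    -- One factor 2 comes from `2d` in the weight, the other from the halves `k ≥ 0` and `k < 0`,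
    -- which `mirror` exchanges without touching `d`.
    X-sum : ∑ᴱ (X n) (weight n) ≡ + 4 * ∑ᴱ X≥0 f
    X-sum = begin
      ∑ᴱ (X n) (weight n)
        ≡⟨ ∑-cong (list (X n)) (λ (k , d , _) → spread (- ε d) d k) ⟩
      ∑ᴱ (X n) (λ (k , d , e) → + 2 * f (k , d , e) + - ε d * (+ 2 * k + 1ℤ))
        ≡⟨ ∑-+ _ _ (list (X n)) ⟩
      ∑ᴱ (X n) (λ x → + 2 * f x) + ∑ᴱ (X n) (λ (k , d , _) → - ε d * (+ 2 * k + 1ℤ))
        ≡⟨ cong₂ _+_ (∑-*ˡ (+ 2) f (list (X n))) odd-part ⟩
      + 2 * ∑ᴱ (X n) f + 0ℤ
        ≡⟨ cong (λ s → + 2 * s + 0ℤ) (trans (split (X n) nonneg? f) (cong (λ s → ∑ᴱ X≥0 f + s) (sym X<0≡X≥0))) ⟩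
      + 2 * (∑ᴱ X≥0 f + ∑ᴱ X≥0 f) + 0ℤ
        ≡⟨ collect (∑ᴱ X≥0 f) ⟩
      + 4 * ∑ᴱ X≥0 f ∎
      where
      open ≡-Reasoning
      spread : ∀ s d k → s * (+ 2 * d + (+ 2 * k + 1ℤ)) ≡ + 2 * (s * d) + s * (+ 2 * k + 1ℤ)
      spread = solve-∀
      collect : ∀ a → + 2 * (a + a) + 0ℤ ≡ + 4 * a
      collect = solve-∀

    module _ (N : ℕ) (n≤N : n ℕ.≤ N) where

      tri-form : ∀ k d e → + k * (+ k + 1ℤ) + + 2 * (d * e) ≡ + 2 * (+ tri k + d * e)
      tri-form k d e = trans (cong (_+ + 2 * (d * e)) (k*suc-k k)) (sym (ℤₚ.*-distribˡ-+ (+ 2) (+ tri k) (d * e)))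

      below▹D : Enum (λ kde → proj₁ kde ℕ.< suc N × D-cond n (tri (proj₁ kde)) (proj₂ kde))
      below▹D = below (suc N) ▹ λ k → D n (tri k)

      -- Nonzero terms have `k ≤ tri k ≤ n ≤ N`. The free cut-off `N` lets one range of indices
      -- serve all coefficients when four series are multiplied.
      X≥0-sum : ∑ᴱ X≥0 f ≡ ∑[ k ∈ downFrom (suc N) ] altσ n (tri k)
      X≥0-sum = trans (sym (reindex below▹D X≥0 {f = λ (k , de) → signed de}
          (λ (k , de) → + k , de) (λ (k , de) → ∣ k ∣ , de) to from
          (λ _ _ → refl) back (λ _ _ → refl)))
        (∑-▹ (below (suc N)) (λ k → D n (tri k)) _)
        where
        to : ∀ kde → proj₁ kde ℕ.< suc N × D-cond n (tri (proj₁ kde)) (proj₂ kde) →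
             InX n (+ proj₁ kde , proj₂ kde) × Pos (+ proj₁ kde + 1ℤ)
        to (k , d , e) (_ , d>0 , e>0 , eq) =
          (d>0 , e>0 , trans (tri-form k d e) (cong (+ 2 *_) eq)) , subst Pos (ℤₚ.+-comm 1ℤ (+ k)) (pos k)
        nonneg : ∀ k → Pos (k + 1ℤ) → + ∣ k ∣ ≡ k
        nonneg (+ _) _ = refl
        nonneg -[1+ zero ] ()
        nonneg -[1+ suc _ ] ()
        back : ∀ x → InX n x × Pos (proj₁ x + 1ℤ) → (+ ∣ proj₁ x ∣ , proj₂ x) ≡ x
        back (k , de) (_ , p) = cong (_, de) (nonneg k p)
        from : ∀ x → InX n x × Pos (proj₁ x + 1ℤ) → ∣ proj₁ x ∣ ℕ.< suc N × D-cond n (tri ∣ proj₁ x ∣) (proj₂ x)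
        from (+ k , d , e) ((pos p , pos q , eq) , _) =
          ℕ.s≤s (ℕₚ.≤-trans (k≤tri k) (ℕₚ.≤-trans (ℕₚ.m≤m+n (tri k) _) (ℕₚ.≤-trans (ℕₚ.≤-reflexive (ℤₚ.+-injective eq′)) n≤N))) ,
          pos p , pos q , eq′
          where
          eq′ : + tri k + + suc p * + suc q ≡ + n
          eq′ = ℤₚ.*-cancelˡ-≡ (+ 2) _ _ (trans (sym (tri-form k (+ suc p) (+ suc q))) eq)
        from (-[1+ zero ] , _) (_ , ())
        from (-[1+ suc _ ] , _) (_ , ())

      Pronic-sum : ∑ᴱ (Pronic n) (λ _ → + n) ≡ ∑[ k ∈ downFrom (suc N) ] ind (tri k ℕ.≟ n) (+ n)
      Pronic-sum = trans (reindex-id (Pronic n) roots to from) (∑-filter (λ k → tri k ℕ.≟ n) _ (downFrom (suc N)))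
        where
        roots : Enum (λ k → tri k ≡ n)
        roots = restrict (below (suc N)) (λ k → tri k ℕ.≟ n) λ k eq →
                  ℕ.s≤s (ℕₚ.≤-trans (k≤tri k) (ℕₚ.≤-trans (ℕₚ.≤-reflexive eq) n≤N))
        to : ∀ k → k ℕ.* suc k ≡ 2 ℕ.* n → tri k ≡ n
        to k eq = ℕₚ.*-cancelˡ-≡ (tri k) n 2 (trans (2*tri k) eq)
        from : ∀ k → tri k ≡ n → k ℕ.* suc k ≡ 2 ℕ.* n
        from k eq = trans (sym (2*tri k)) (cong (2 ℕ.*_) eq)

  -- The coefficient of qⁿ in ψ · A = q ψ′, where ψ(q) = Σ q^(tri k) and A(q) = Σ altσ n 0 qⁿ.
  ψ-log-derivative : ∀ N → n ℕ.≤ N →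
    (∑[ k ∈ downFrom (suc N) ] altσ n (tri k)) ≡ (∑[ k ∈ downFrom (suc N) ] ind (tri k ℕ.≟ n) (+ n))
  ψ-log-derivative N n≤N = ℤₚ.*-cancelˡ-≡ (+ 4) _ _ (begin
    + 4 * (∑[ k ∈ downFrom (suc N) ] altσ n (tri k))           ≡⟨ cong (+ 4 *_) (X≥0-sum N n≤N) ⟨
    + 4 * ∑ᴱ X≥0 f                                             ≡⟨ X-sum ⟨
    ∑ᴱ (X n) (weight n)                                        ≡⟨ sum-X n ⟩
    ∑ᴱ (Pronic n) (λ _ → + 4 * + n)                                 ≡⟨ ∑-*ˡ (+ 4) _ (list (Pronic n)) ⟩
    + 4 * ∑ᴱ (Pronic n) (λ _ → + n)                                 ≡⟨ cong (+ 4 *_) (Pronic-sum N n≤N) ⟩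
    + 4 * (∑[ k ∈ downFrom (suc N) ] ind (tri k ℕ.≟ n) (+ n))  ∎)
    where open ≡-Reasoning

-- The convolution of odd divisor sums

-- Splittings of `e` into an ordered sum of two positive parts. They parametrise the diagonals
-- `a = b` and `x = y`, where the sum of the other two variables is a divisor of `N`.
gap : ∀ e → Enum (λ z → Pos z × Pos (e - z))
gap e = restrict (ball ∣ e ∣) (λ z → pos? z ×-dec pos? (e - z)) λ z (z>0 , e-z>0) →
  subst (λ u → ∣ z ∣ ℕ.≤ ∣ u ∣) (cancel z e) (bound z>0 e-z>0)
  where
  cancel : ∀ z e → z + (e - z) ≡ e
  cancel = solve-∀
  bound : ∀ {x y} → Pos x → Pos y → ∣ x ∣ ℕ.≤ ∣ x + y ∣
  bound (pos m) (pos n) = ℕₚ.m≤m+n (suc m) (suc n)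

Pos⇒< : ∀ x y → Pos (x - y) → y < x
Pos⇒< x y p = subst₂ _<_ (ℤₚ.+-identityˡ y) (cancel x y) (ℤₚ.+-monoˡ-< y (positive p))
  where
  positive : ∀ {z} → Pos z → 0ℤ < z
  positive (pos n) = +<+ (ℕ.s≤s ℕ.z≤n)
  cancel : ∀ x y → x - y + y ≡ x
  cancel = solve-∀

∑-gap : ∀ q (g : ℤ → ℤ) → ∑ᴱ (gap (+ suc q)) g ≡ ∑[ i ∈ downFrom q ] g (+ suc i)
∑-gap q g = sym (reindex (below q) (gap (+ suc q)) (λ i → + suc i) (λ z → ℕ.pred ∣ z ∣)
  to from (λ _ _ → refl) (λ { _ (pos _ , _) → refl }) (λ _ _ → refl))
  where
  to : ∀ i → i ℕ.< q → Pos (+ suc i) × Pos (+ suc q - + suc i)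
  to i i<q with m , refl ← <⇒∃ i<q =
    pos i , subst Pos (shape (+ suc i) (+ m)) (pos m)
    where
    shape : ∀ a b → 1ℤ + b ≡ 1ℤ + (a + b) - a
    shape = solve-∀
  from : ∀ z → Pos z × Pos (+ suc q - z) → ℕ.pred ∣ z ∣ ℕ.< q
  from _ (pos i , p) = ℕₚ.≤-pred (ℤₚ.drop‿+<+ (Pos⇒< _ _ p))

-- Liouville's method for `ax + by = N`

ℤ⁴ : Set
ℤ⁴ = ℤ × ℤ × ℤ × ℤ

InS : ℕ → ℤ⁴ → Set
InS N (a , b , x , y) = Pos a × Pos b × Pos x × Pos y × a * x + b * y ≡ + N

S : ∀ N → Enum (InS N)
S N = restrict (ball N ⊗ ball N ⊗ ball N ⊗ ball N)
  (λ (a , b , x , y) → pos? a ×-dec pos? b ×-dec pos? x ×-dec pos? y ×-dec (a * x + b * y ℤₚ.≟ + N))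
  bounds
  where
  bounds : ∀ s → InS N s → ∣ proj₁ s ∣ ℕ.≤ N × ∣ proj₁ (proj₂ s) ∣ ℕ.≤ N ×
           ∣ proj₁ (proj₂ (proj₂ s)) ∣ ℕ.≤ N × ∣ proj₂ (proj₂ (proj₂ s)) ∣ ℕ.≤ N
  bounds _ (pos a , pos b , pos x , pos y , eq) =
    ℕₚ.≤-trans (ℕₚ.m≤m*n (suc a) (suc x)) ax≤ , ℕₚ.≤-trans (ℕₚ.m≤m*n (suc b) (suc y)) by≤ ,
    ℕₚ.≤-trans (ℕₚ.m≤n*m (suc x) (suc a)) ax≤ , ℕₚ.≤-trans (ℕₚ.m≤n*m (suc y) (suc b)) by≤
    where
    ax≤ : suc a ℕ.* suc x ℕ.≤ N
    ax≤ = ℕₚ.≤-trans (ℕₚ.m≤m+n _ (suc b ℕ.* suc y)) (ℕₚ.≤-reflexive (ℤₚ.+-injective eq))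
    by≤ : suc b ℕ.* suc y ℕ.≤ N
    by≤ = ℕₚ.≤-trans (ℕₚ.m≤n+m _ (suc a ℕ.* suc x)) (ℕₚ.≤-reflexive (ℤₚ.+-injective eq))

quad-≡ : ∀ {a a′ b b′ x x′ y y′ : ℤ} → a ≡ a′ → b ≡ b′ → x ≡ x′ → y ≡ y′ →
         (a , b , x , y) ≡ (a′ , b′ , x′ , y′)
quad-≡ refl refl refl refl = refl

module Liouville (N : ℕ) (f : ℤ → ℤ) (f-even : ∀ z → f (- z) ≡ f z) (f-0 : f 0ℤ ≡ 0ℤ) where

  dab dxy : ℤ⁴ → ℤ
  dab (a , b , x , y) = a - b
  dxy (a , b , x , y) = x - y

  a>b : Enum (λ s → InS N s × Pos (dab s))
  a>b = S N ∩ λ s → pos? (dab s)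
  a=b : Enum (λ s → InS N s × dab s ≡ 0ℤ)
  a=b = S N ∩ λ s → zero? (dab s)
  a<b : Enum (λ s → InS N s × Pos (- dab s))
  a<b = S N ∩ λ s → pos? (- dab s)
  x>y : Enum (λ s → InS N s × Pos (dxy s))
  x>y = S N ∩ λ s → pos? (dxy s)
  x=y : Enum (λ s → InS N s × dxy s ≡ 0ℤ)
  x=y = S N ∩ λ s → zero? (dxy s)
  x<y : Enum (λ s → InS N s × Pos (- dxy s))
  x<y = S N ∩ λ s → pos? (- dxy s)

  f₁ f₋ f₊ : ℤ⁴ → ℤ
  f₁ (a , _) = f a
  f₋ (a , b , _) = f (a - b)
  f₊ (a , b , _) = f (a + b)

  exchange : ℤ⁴ → ℤ⁴
  exchange (a , b , x , y) = b , a , y , x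

  exchange-ok : ∀ s → InS N s → InS N (exchange s)
  exchange-ok (a , b , x , y) (a>0 , b>0 , x>0 , y>0 , eq) = b>0 , a>0 , y>0 , x>0 , trans (ℤₚ.+-comm (b * y) (a * x)) eq

  private
    neg-sub : ∀ a b → - (a - b) ≡ b - a
    neg-sub = solve-∀
    sub-neg : ∀ a b → a - b ≡ - (b - a)
    sub-neg = solve-∀
    a-b+b : ∀ a b → a - b + b ≡ a
    a-b+b = solve-∀
    a+b-b : ∀ a b → a + b - b ≡ a
    a+b-b = solve-∀

    exchange-< : ∀ {g h : ℤ⁴ → ℤ} → (∀ s → g s ≡ h (exchange s)) → ∑ᴱ a<b g ≡ ∑ᴱ a>b h
    exchange-< eq = reindex a<b a>b exchange exchange
      (λ (a , b , x , y) (inS , p) → exchange-ok (a , b , x , y) inS , subst Pos (neg-sub a b) p)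
      (λ (a , b , x , y) (inS , p) → exchange-ok (a , b , x , y) inS , subst Pos (sub-neg a b) p)
      (λ _ _ → refl) (λ _ _ → refl) (λ s _ → eq s)

    exchange-xy : ∀ {g h : ℤ⁴ → ℤ} → (∀ s → g s ≡ h (exchange s)) → ∑ᴱ x>y g ≡ ∑ᴱ x<y h
    exchange-xy eq = reindex x>y x<y exchange exchange
      (λ (a , b , x , y) (inS , p) → exchange-ok (a , b , x , y) inS , subst Pos (sub-neg x y) p)
      (λ (a , b , x , y) (inS , p) → exchange-ok (a , b , x , y) inS , subst Pos (neg-sub x y) p)
      (λ _ _ → refl) (λ _ _ → refl) (λ s _ → eq s)

    -- Rests on `ax + by = (a - b) x + b (x + y)`. The comparison moves from `a , b` to `x , y`;
    -- thereby `f(a - b)` turns into `f(a)`, and `f(a)` into `f(a + b)`.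
    shear : ∀ {g h : ℤ⁴ → ℤ} → (∀ a b x y → g (a , b , x , y) ≡ h (a - b , b , x , x + y)) → ∑ᴱ a>b g ≡ ∑ᴱ x<y h
    shear eq = reindex a>b x<y
      (λ (a , b , x , y) → a - b , b , x , x + y)
      (λ (a , b , x , y) → a + b , b , x , y - x)
      (λ (a , b , x , y) ((a>0 , b>0 , x>0 , y>0 , e) , p) →
        (p , b>0 , x>0 , Pos-+ x>0 y>0 , trans (form a b x y) e) , subst Pos (diff x y) y>0)
      (λ (a , b , x , y) ((a>0 , b>0 , x>0 , y>0 , e) , p) →
        (Pos-+ a>0 b>0 , b>0 , x>0 , subst Pos (neg-sub x y) p , trans (form′ a b x y) e)
        , subst Pos (sym (a+b-b a b)) a>0)
      (λ (a , b , x , y) _ → quad-≡ (a-b+b a b) refl refl (x+y-x x y))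
      (λ (a , b , x , y) _ → quad-≡ (a+b-b a b) refl refl (x+[y-x] x y))
      (λ (a , b , x , y) _ → eq a b x y)
      where
      form : ∀ a b x y → (a - b) * x + b * (x + y) ≡ a * x + b * y
      form = solve-∀
      form′ : ∀ a b x y → (a + b) * x + b * (y - x) ≡ a * x + b * y
      form′ = solve-∀
      diff : ∀ x y → y ≡ - (x - (x + y))
      diff = solve-∀
      x+y-x : ∀ x y → x + y - x ≡ y
      x+y-x = solve-∀
      x+[y-x] : ∀ x y → x + (y - x) ≡ y
      x+[y-x] = solve-∀

    -- The companion `ax + by = a (x + y) + (b - a) y` leaves `a`, hence `f₁`, unchanged.
    shear′ : ∑ᴱ a<b f₁ ≡ ∑ᴱ x>y f₁
    shear′ = reindex a<b x>y
      (λ (a , b , x , y) → a , b - a , x + y , y)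
      (λ (a , b , x , y) → a , b + a , x - y , y)
      (λ (a , b , x , y) ((a>0 , b>0 , x>0 , y>0 , e) , p) →
        (a>0 , subst Pos (neg-sub a b) p , Pos-+ x>0 y>0 , y>0 , trans (form a b x y) e) , subst Pos (sym (a+b-b x y)) x>0)
      (λ (a , b , x , y) ((a>0 , b>0 , x>0 , y>0 , e) , p) →
        (a>0 , Pos-+ b>0 a>0 , p , y>0 , trans (form′ a b x y) e) , subst Pos (diff a b) b>0)
      (λ (a , b , x , y) _ → quad-≡ refl (a-b+b b a) (a+b-b x y) refl)
      (λ (a , b , x , y) _ → quad-≡ refl (a+b-b b a) (a-b+b x y) refl)
      (λ _ _ → refl)
      where
      form : ∀ a b x y → a * (x + y) + (b - a) * y ≡ a * x + b * y
      form = solve-∀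
      form′ : ∀ a b x y → a * (x - y) + (b + a) * y ≡ a * x + b * y
      form′ = solve-∀
      diff : ∀ a b → b ≡ - (a - (b + a))
      diff = solve-∀

    sum-f₋ : ∑ᴱ (S N) f₋ ≡ ∑ᴱ x<y f₁ + (0ℤ + ∑ᴱ x<y f₁)
    sum-f₋ = trans (split-sign (S N) dab f₋)
      (cong₂ _+_ (shear λ _ _ _ _ → refl)
        (cong₂ _+_ (trans (∑ᴱ-cong a=b λ _ (_ , z) → trans (cong f z) f-0) (∑-zero (list a=b)))
                   (trans (exchange-< {f₋} {f₋} λ (a , b , _) → trans (sym (f-even (a - b))) (cong f (neg-sub a b)))
                          (shear λ _ _ _ _ → refl))))

    sum-f₊ : ∑ᴱ (S N) f₊ ≡ ∑ᴱ a>b f₁ + (∑ᴱ x=y f₊ + ∑ᴱ a>b f₁)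
    sum-f₊ = trans (split-sign (S N) dxy f₊)
      (cong₂ _+_ (trans (exchange-xy {f₊} {f₊} λ (a , b , _) → cong f (ℤₚ.+-comm a b)) x<y-sum)
                 (cong (λ s → ∑ᴱ x=y f₊ + s) x<y-sum))
      where
      x<y-sum : ∑ᴱ x<y f₊ ≡ ∑ᴱ a>b f₁
      x<y-sum = sym (shear λ a b _ _ → cong f (sym (a-b+b a b)))

    -- The sum of `f(a)` over all solutions, cut once by the sign of `a - b` and once by that of
    -- `x - y`.
    balance : ∑ᴱ a>b f₁ + (∑ᴱ a=b f₁ + ∑ᴱ x>y f₁) ≡ ∑ᴱ x>y f₁ + (∑ᴱ x=y f₁ + ∑ᴱ x<y f₁)
    balance = trans (cong (λ s → ∑ᴱ a>b f₁ + (∑ᴱ a=b f₁ + s)) (sym shear′))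
      (trans (sym (split-sign (S N) dab f₁)) (split-sign (S N) dxy f₁))

  -- Off the diagonals, `f₋` gives twice the sum of `f₁` over `x<y`, and `f₊` twice its sum over
  -- `a>b`. Their difference is a difference of diagonal sums by `balance`.
  liouville : ∑ᴱ (S N) f₋ - ∑ᴱ (S N) f₊ ≡ + 2 * ∑ᴱ a=b f₁ - + 2 * ∑ᴱ x=y f₁ - ∑ᴱ x=y f₊
  liouville = trans (cong₂ _-_ sum-f₋ sum-f₊) (combine (∑ᴱ a>b f₁) (∑ᴱ a=b f₁) (∑ᴱ x>y f₁) (∑ᴱ x=y f₁) (∑ᴱ x<y f₁) (∑ᴱ x=y f₊) balance)
    where
    combine : ∀ p q r s t u → p + (q + r) ≡ r + (s + t) →
              t + (0ℤ + t) - (p + (u + p)) ≡ + 2 * q - + 2 * s - u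
    combine p q r s t u eq = trans (expand p q r s t u)
      (trans (cong (λ z → + 2 * (z - (p + (q + r))) + (+ 2 * q - + 2 * s - u)) (sym eq)) (cancel (p + (q + r)) q s u))
      where
      expand : ∀ p q r s t u → t + (0ℤ + t) - (p + (u + p))
               ≡ + 2 * (r + (s + t) - (p + (q + r))) + (+ 2 * q - + 2 * s - u)
      expand = solve-∀
      cancel : ∀ z q s u → + 2 * (z - z) + (+ 2 * q - + 2 * s - u) ≡ + 2 * q - + 2 * s - u
      cancel = solve-∀

  private
    merge : ∀ a x y → a * (x + y) ≡ a * x + a * y
    merge = solve-∀
    merge′ : ∀ a b x → (a + b) * x ≡ a * x + b * x
    merge′ = solve-∀

  -- On `a = b` the equation is `a (x + y) = N`: a factorisation of `N` together with a splitting of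
  -- the cofactor of `a`.
  sum-a=b : ∀ {g : ℤ⁴ → ℤ} (h : ℤ → ℤ) → (∀ a b x y → g (a , b , x , y) ≡ h a) →
            ∑ᴱ a=b g ≡ ∑[ (d , e) ∈ list (D N 0) ] ∑[ _ ∈ list (gap e) ] h d
  sum-a=b {g} h gh = trans (reindex a=b fibres {g = λ ((d , _) , _) → h d}
      (λ (a , b , x , y) → (a , x + y) , x) (λ ((d , e) , z) → d , d , z , e - z) to from
      (λ (a , b , x , y) (_ , p) → quad-≡ refl (ℤₚ.i-j≡0⇒i≡j a b p) refl (cancel x y))
      (λ ((d , e) , z) _ → cong (λ w → (d , w) , z) (cancel′ z e))
      (λ (a , b , x , y) _ → gh a b x y))
    (∑-▹ (D N 0) (λ (d , e) → gap e) _)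
    where
    fibres : Enum (λ dez → D-cond N 0 (proj₁ dez) × (Pos (proj₂ dez) × Pos (proj₂ (proj₁ dez) - proj₂ dez)))
    fibres = D N 0 ▹ λ (d , e) → gap e
    cancel : ∀ x y → x + y - x ≡ y
    cancel = solve-∀
    cancel′ : ∀ z e → z + (e - z) ≡ e
    cancel′ = solve-∀
    to : ∀ s → InS N s × dab s ≡ 0ℤ → _
    to (a , b , x , y) ((a>0 , b>0 , x>0 , y>0 , e) , p) with refl ← ℤₚ.i-j≡0⇒i≡j a b p =
      (a>0 , Pos-+ x>0 y>0 , trans (ℤₚ.+-identityˡ _) (trans (merge a x y) e)) , x>0 , subst Pos (sym (cancel x y)) y>0
    from : ∀ dez → D-cond N 0 (proj₁ dez) × (Pos (proj₂ dez) × Pos (proj₂ (proj₁ dez) - proj₂ dez)) → _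
    from ((d , e) , z) ((d>0 , e>0 , eq) , z>0 , p) =
      (d>0 , d>0 , z>0 , p , trans (sym (merge d z (e - z))) (trans (cong (d *_) (cancel′ z e)) (trans (sym (ℤₚ.+-identityˡ _)) eq)))
      , ℤₚ.+-inverseʳ d

  -- On `x = y` it is `a + b` that divides `N`, and `a` ranges over the splittings of this divisor.
  sum-x=y : ∀ {g : ℤ⁴ → ℤ} (h : ℤ → ℤ → ℤ) → (∀ a b x y → g (a , b , x , y) ≡ h (a + b) a) →
            ∑ᴱ x=y g ≡ ∑[ (d , e) ∈ list (D N 0) ] ∑[ z ∈ list (gap d) ] h d z
  sum-x=y {g} h gh = trans (reindex x=y fibres {g = λ ((d , _) , z) → h d z}
      (λ (a , b , x , y) → (a + b , x) , a) (λ ((d , e) , z) → z , d - z , e , e) to from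
      (λ (a , b , x , y) (_ , p) → quad-≡ refl (cancel a b) refl (ℤₚ.i-j≡0⇒i≡j x y p))
      (λ ((d , e) , z) _ → cong (λ w → (w , e) , z) (cancel′ z d))
      (λ (a , b , x , y) _ → gh a b x y))
    (∑-▹ (D N 0) (λ (d , e) → gap d) _)
    where
    fibres : Enum (λ dez → D-cond N 0 (proj₁ dez) × (Pos (proj₂ dez) × Pos (proj₁ (proj₁ dez) - proj₂ dez)))
    fibres = D N 0 ▹ λ (d , e) → gap d
    cancel : ∀ x y → x + y - x ≡ y
    cancel = solve-∀
    cancel′ : ∀ z e → z + (e - z) ≡ e
    cancel′ = solve-∀
    to : ∀ s → InS N s × dxy s ≡ 0ℤ → _
    to (a , b , x , y) ((a>0 , b>0 , x>0 , y>0 , e) , p) with refl ← ℤₚ.i-j≡0⇒i≡j x y p =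
      (Pos-+ a>0 b>0 , x>0 , trans (ℤₚ.+-identityˡ _) (trans (merge′ a b x) e)) , a>0 , subst Pos (sym (cancel a b)) b>0
    from : ∀ dez → D-cond N 0 (proj₁ dez) × (Pos (proj₂ dez) × Pos (proj₁ (proj₁ dez) - proj₂ dez)) → _
    from ((d , e) , z) ((d>0 , e>0 , eq) , z>0 , p) =
      (z>0 , p , e>0 , e>0 , trans (sym (merge′ z (d - z) e)) (trans (cong (_* e) (cancel′ z d)) (trans (sym (ℤₚ.+-identityˡ _)) eq)))
      , ℤₚ.+-inverseʳ e

-- Parity of products and the quadratic test function

ε-even-* : ∀ x q → ε x ≡ 1ℤ → ε (x * + q) ≡ 1ℤ
ε-even-* x zero    _  = cong ε (ℤₚ.*-zeroʳ x)
ε-even-* x (suc q) εx = trans (cong ε (ℤₚ.*-suc x (+ q))) (trans (ε-+ x (x * + q))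
  (trans (cong (_* ε (x * + q)) εx) (trans (ℤₚ.*-identityˡ _) (ε-even-* x q εx))))

ε-odd-* : ∀ x q → ε x ≡ - 1ℤ → ε (x * + q) ≡ ε (+ q)
ε-odd-* x zero    _  = cong ε (ℤₚ.*-zeroʳ x)
ε-odd-* x (suc q) εx = trans (cong ε (ℤₚ.*-suc x (+ q))) (trans (ε-+ x (x * + q))
  (trans (cong₂ _*_ εx (ε-odd-* x q εx)) (ℤₚ.-1*i≡-i _)))

ε-factor : ∀ x y → Pos y → ε (x * y) ≡ - 1ℤ → ε x ≡ - 1ℤ
ε-factor x y (pos q) εxy with ε-values x
... | inj₂ odd  = odd
... | inj₁ even with () ← trans (sym (ε-even-* x (suc q) even)) εxy

ε-1+2n : ∀ n → ε (+ (1 ℕ.+ 2 ℕ.* n)) ≡ - 1ℤ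
ε-1+2n n = trans (cong (λ m → ε (+ suc m)) (cong (n ℕ.+_) (ℕₚ.+-identityʳ n))) (ε-odd (+ n))

ε-2n : ∀ n → ε (+ (2 ℕ.* n)) ≡ 1ℤ
ε-2n n = trans (cong (λ m → ε (+ m)) (cong (n ℕ.+_) (ℕₚ.+-identityʳ n))) (ε-double (+ n))

-- 8z² for even z and −2z² for odd z: the weights that make the halving of the even
-- factor in doubled-altσ produce signed divisor sums.
sq : ℤ → ℤ
sq z = z * z * (+ 3 + + 5 * ε z)

sq-even : ∀ z → sq (- z) ≡ sq z
sq-even z = trans (cong (λ s → - z * - z * (+ 3 + + 5 * s)) (ε-neg z)) (square z (+ 3 + + 5 * ε z))
  where
  square : ∀ z s → - z * - z * s ≡ z * z * s
  square = solve-∀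

-- Doubling clears the denominators: over `0 < z < d`, `6 Σ z²` is `2d³ - 3d² + d`, and
-- `2 Σ (-1)^z z²` is `-(-1)^d (d² - d)`.
∑-sq : ∀ q → + 2 * ∑ (downFrom q) (λ i → sq (+ suc i)) ≡
       (let d = + suc q in + 2 * d * d * d - + 3 * d * d + d - + 5 * ε d * (d * d - d))
∑-sq zero    = refl
∑-sq (suc q) = trans (ℤₚ.*-distribˡ-+ (+ 2) (sq (+ suc q)) _)
  (trans (cong (λ s → + 2 * sq (+ suc q) + s) (∑-sq q)) (step (+ suc q) (ε (+ suc q))))
  where
  step : ∀ d s → + 2 * (d * d * (+ 3 + + 5 * s)) + (+ 2 * d * d * d - + 3 * d * d + d - + 5 * s * (d * d - d))
         ≡ + 2 * (1ℤ + d) * (1ℤ + d) * (1ℤ + d) - + 3 * (1ℤ + d) * (1ℤ + d) + (1ℤ + d)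
           - + 5 * (- s) * ((1ℤ + d) * (1ℤ + d) - (1ℤ + d))
  step = solve-∀

σ′ : ℕ → ℤ
σ′ m = ∑ᴱ (D m 0) proj₁

product-term : ℤ⁴ → ℤ
product-term (a , b , _) = a * b * (+ 3 + + 5 * ε (a + b))

module _ (n : ℕ) where

  private
    N : ℕ
    N = 1 ℕ.+ 2 ℕ.* n

    open Liouville N sq sq-even refl

    -- `a - b` and `a + b` have the same parity, so `sq` multiplies both squares by the same
    -- coefficient, and their difference leaves `-4ab`.
    polarise : ∑ᴱ (S N) f₋ - ∑ᴱ (S N) f₊ ≡ - + 4 * ∑ᴱ (S N) product-term
    polarise = begin
      ∑ᴱ (S N) f₋ - ∑ᴱ (S N) f₊                  ≡⟨ cong (λ s → ∑ᴱ (S N) f₋ + s) (ℤₚ.-1*i≡-i _) ⟨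
      ∑ᴱ (S N) f₋ + - 1ℤ * ∑ᴱ (S N) f₊           ≡⟨ cong (λ s → ∑ᴱ (S N) f₋ + s) (∑-*ˡ (- 1ℤ) f₊ (list (S N))) ⟨
      ∑ᴱ (S N) f₋ + ∑ᴱ (S N) (λ s → - 1ℤ * f₊ s) ≡⟨ ∑-+ f₋ _ (list (S N)) ⟨
      ∑ᴱ (S N) (λ s → f₋ s + - 1ℤ * f₊ s)        ≡⟨ ∑-cong (list (S N)) pointwise ⟩
      ∑ᴱ (S N) (λ s → - + 4 * product-term s)    ≡⟨ ∑-*ˡ (- + 4) product-term (list (S N)) ⟩
      - + 4 * ∑ᴱ (S N) product-term              ∎
      where
      open ≡-Reasoning
      pointwise : ∀ s → f₋ s + - 1ℤ * f₊ s ≡ - + 4 * product-term s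
      pointwise (a , b , _) = trans (cong (λ s → (a - b) * (a - b) * (+ 3 + + 5 * s) + - 1ℤ * f (a + b)) same-parity)
                                    (expand a b (ε (a + b)))
        where
        f : ℤ → ℤ
        f = sq
        shape : ∀ a b → a + b ≡ a - b + (b + b)
        shape = solve-∀
        same-parity : ε (a - b) ≡ ε (a + b)
        same-parity = sym (trans (cong ε (shape a b)) (ε-+double (a - b) b))
        expand : ∀ a b s → (a - b) * (a - b) * (+ 3 + + 5 * s) + - 1ℤ * ((a + b) * (a + b) * (+ 3 + + 5 * s))
                 ≡ - + 4 * (a * b * (+ 3 + + 5 * s))
        expand = solve-∀

    -- A factorisation `d e = N` contributes `2 (e - 1) f(d) - 2 Σ f(z) - (d - 1) f(d)`, with
    -- `0 < z < d` and `d` odd. If `sq` had `α + β ε z` for `3 + 5 ε z`, the coefficient of `d³`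
    -- would be `-2α/3 - (α - β)`, which vanishes for `α : β = 3 : 5`. There remains
    -- `-4 (d e - 1) d = -8 n d`.
    diagonal : + 2 * ∑ᴱ a=b f₁ - + 2 * ∑ᴱ x=y f₁ - ∑ᴱ x=y f₊ ≡ - + 8 * + n * σ′ N
    diagonal = begin
      + 2 * ∑ᴱ a=b f₁ - + 2 * ∑ᴱ x=y f₁ - ∑ᴱ x=y f₊
        ≡⟨ cong₂ _-_ (cong₂ (λ p q → + 2 * p - + 2 * q) (sum-a=b sq λ _ _ _ _ → refl) (sum-x=y (λ _ z → sq z) λ _ _ _ _ → refl))
                     (sum-x=y (λ d _ → sq d) λ _ _ _ _ → refl) ⟩
      + 2 * ∑ DN P - + 2 * ∑ DN Q - ∑ DN T
        ≡⟨ regroup (∑ DN P) (∑ DN Q) (∑ DN T) ⟩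
      + 2 * ∑ DN P + (- + 2 * ∑ DN Q + - 1ℤ * ∑ DN T)
        ≡⟨ cong₂ _+_ (sym (∑-*ˡ (+ 2) P DN)) (trans (cong₂ _+_ (sym (∑-*ˡ (- + 2) Q DN)) (sym (∑-*ˡ (- 1ℤ) T DN))) (sym (∑-+ _ _ DN))) ⟩
      ∑ DN (λ de → + 2 * P de) + ∑ DN (λ de → - + 2 * Q de + - 1ℤ * T de)
        ≡⟨ ∑-+ _ _ DN ⟨
      ∑ DN (λ de → + 2 * P de + (- + 2 * Q de + - 1ℤ * T de))
        ≡⟨ ∑ᴱ-cong (D N 0) pointwise ⟩
      ∑ DN (λ (d , _) → - + 8 * + n * d)
        ≡⟨ ∑-*ˡ (- + 8 * + n) proj₁ DN ⟩
      - + 8 * + n * σ′ N ∎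
      where
      open ≡-Reasoning
      DN : List (ℤ × ℤ)
      DN = list (D N 0)
      P Q T : ℤ × ℤ → ℤ
      P (d , e) = ∑[ _ ∈ list (gap e) ] sq d
      Q (d , e) = ∑[ z ∈ list (gap d) ] sq z
      T (d , e) = ∑[ _ ∈ list (gap d) ] sq d
      regroup : ∀ p q t → + 2 * p - + 2 * q - t ≡ + 2 * p + (- + 2 * q + - 1ℤ * t)
      regroup = solve-∀
      pointwise : ∀ de → D-cond N 0 de → + 2 * P de + (- + 2 * Q de + - 1ℤ * T de) ≡ - + 8 * + n * proj₁ de
      pointwise (d , e) (pos p , pos q , eq) = begin
        + 2 * P (d , e) + (- + 2 * Q (d , e) + - 1ℤ * T (d , e))
          ≡⟨ cong₂ (λ u w → + 2 * u + w) (const-gap q) (cong₂ _+_ (trans (neg-out (Q (d , e))) (cong -_ twice-Q)) (cong (- 1ℤ *_) (const-gap p))) ⟩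
        + 2 * (+ q * sq d) + (- (+ 2 * d * d * d - + 3 * d * d + d - + 5 * ε d * (d * d - d)) + - 1ℤ * (+ p * sq d))
          ≡⟨ cong (λ s → + 2 * (+ q * (d * d * (+ 3 + + 5 * s))) + (- (+ 2 * d * d * d - + 3 * d * d + d - + 5 * s * (d * d - d)) + - 1ℤ * (+ p * (d * d * (+ 3 + + 5 * s))))) d-odd ⟩
        + 2 * (+ q * (d * d * (+ 3 + + 5 * - 1ℤ))) + (- (+ 2 * d * d * d - + 3 * d * d + d - + 5 * - 1ℤ * (d * d - d)) + - 1ℤ * (+ p * (d * d * (+ 3 + + 5 * - 1ℤ))))
          ≡⟨ collect (+ p) (+ q) ⟩
        - + 4 * (d * e - 1ℤ) * d
          ≡⟨ cong (λ s → - + 4 * (s - 1ℤ) * d) (trans (sym (ℤₚ.+-identityˡ (d * e))) (trans eq (cong (λ s → 1ℤ + s) (ℤₚ.pos-* 2 n)))) ⟩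
        - + 4 * (1ℤ + + 2 * + n - 1ℤ) * d
          ≡⟨ final (+ n) d ⟩
        - + 8 * + n * d ∎
        where
        const-gap : ∀ r → ∑[ _ ∈ list (gap (+ suc r)) ] sq d ≡ + r * sq d
        const-gap r = trans (∑-gap r (λ _ → sq d)) (∑-const {ℕ} (sq d) r)
        twice-Q : + 2 * Q (d , e) ≡ + 2 * d * d * d - + 3 * d * d + d - + 5 * ε d * (d * d - d)
        twice-Q = trans (cong (+ 2 *_) (∑-gap p sq)) (∑-sq p)
        neg-out : ∀ z → - + 2 * z ≡ - (+ 2 * z)
        neg-out = solve-∀
        d-odd : ε d ≡ - 1ℤ
        d-odd = ε-factor d e (pos q) (trans (cong ε (trans (sym (ℤₚ.+-identityˡ (d * e))) eq)) (ε-1+2n n))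
        collect : ∀ p q → + 2 * (q * ((1ℤ + p) * (1ℤ + p) * (+ 3 + + 5 * - 1ℤ)))
          + (- (+ 2 * (1ℤ + p) * (1ℤ + p) * (1ℤ + p) - + 3 * (1ℤ + p) * (1ℤ + p) + (1ℤ + p) - + 5 * - 1ℤ * ((1ℤ + p) * (1ℤ + p) - (1ℤ + p)))
             + - 1ℤ * (p * ((1ℤ + p) * (1ℤ + p) * (+ 3 + + 5 * - 1ℤ))))
          ≡ - + 4 * ((1ℤ + p) * (1ℤ + q) - 1ℤ) * (1ℤ + p)
        collect = solve-∀
        final : ∀ n d → - + 4 * (1ℤ + + 2 * n - 1ℤ) * d ≡ - + 8 * n * d
        final = solve-∀

  S-sum : + 4 * ∑ᴱ (S (1 ℕ.+ 2 ℕ.* n)) product-term ≡ + 8 * + n * σ′ (1 ℕ.+ 2 ℕ.* n)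
  S-sum = ℤₚ.neg-injective (trans (out₁ (∑ᴱ (S N) product-term)) (trans (sym polarise) (trans liouville (trans diagonal (sym (out₂ (+ n) (σ′ N)))))))
    where
    out₁ : ∀ z → - (+ 4 * z) ≡ - + 4 * z
    out₁ = solve-∀
    out₂ : ∀ n z → - (+ 8 * n * z) ≡ - + 8 * n * z
    out₂ = solve-∀

-- Halving the even factor

half : ℤ → ℤ
half z = + ℕ.⌊ ∣ z ∣ /2⌋

even-half : ∀ m → ε (+ m) ≡ 1ℤ → m ≡ ℕ.⌊ m /2⌋ ℕ.+ ℕ.⌊ m /2⌋
odd-half  : ∀ m → ε (+ m) ≡ - 1ℤ → m ≡ suc (ℕ.⌊ m /2⌋ ℕ.+ ℕ.⌊ m /2⌋)
even-half zero          _  = refl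
even-half (suc zero)    ()
even-half (suc (suc m)) εm = cong suc (trans (cong suc (even-half m (trans (sym (ℤₚ.neg-involutive _)) εm)))
                                             (sym (ℕₚ.+-suc ℕ.⌊ m /2⌋ ℕ.⌊ m /2⌋)))
odd-half zero          ()
odd-half (suc zero)    _  = refl
odd-half (suc (suc m)) εm = cong (λ k → suc (suc k)) (trans (odd-half m (trans (sym (ℤₚ.neg-involutive _)) εm))
                                             (sym (ℕₚ.+-suc ℕ.⌊ m /2⌋ ℕ.⌊ m /2⌋)))

half-double : ∀ z → Pos z → half (+ 2 * z) ≡ z
half-double _ (pos m) = cong +_ (trans (cong ℕ.⌊_/2⌋ (cong (λ k → suc (m ℕ.+ suc k)) (ℕₚ.+-identityʳ m))) (sym (ℕₚ.n≡⌊n+n/2⌋ (suc m))))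

double-half : ∀ z → Pos z → ε z ≡ 1ℤ → + 2 * half z ≡ z
double-half _ (pos m) εz = trans (double (half (+ suc m))) (cong +_ (sym (even-half (suc m) εz)))
  where
  double : ∀ x → + 2 * x ≡ x + x
  double = solve-∀

Pos-half : ∀ z → Pos z → ε z ≡ 1ℤ → Pos (half z)
Pos-half _ (pos zero) ()
Pos-half _ (pos (suc m)) _ = pos ℕ.⌊ m /2⌋

ε-2* : ∀ z → ε (+ 2 * z) ≡ 1ℤ
ε-2* z = trans (cong ε (double z)) (ε-double z)
  where
  double : ∀ x → + 2 * x ≡ x + x
  double = solve-∀

odd? : Decidable {A = ℤ × ℤ} (λ de → ε (proj₁ de) ≡ - 1ℤ)
odd? (d , _) = ε d ℤₚ.≟ - 1ℤ

not-odd⇒even : ∀ z → ¬ (ε z ≡ - 1ℤ) → ε z ≡ 1ℤ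
not-odd⇒even z ¬odd with ε-values z
... | inj₁ even = even
... | inj₂ odd  = ⊥-elim (¬odd odd)

even⇒not-odd : ∀ z → ε z ≡ 1ℤ → ¬ (ε z ≡ - 1ℤ)
even⇒not-odd z even odd with () ← trans (sym even) odd

module _ (n j : ℕ) where

  private
    D₂ : Enum (D-cond (2 ℕ.* n) (2 ℕ.* j))
    D₂ = D (2 ℕ.* n) (2 ℕ.* j)

    g : ℤ × ℤ → ℤ
    g (b , _) = b * (+ 3 - + 5 * ε b)

    halve-eq : ∀ p → + (2 ℕ.* j) + + 2 * p ≡ + (2 ℕ.* n) → + j + p ≡ + n
    halve-eq p eq = ℤₚ.*-cancelˡ-≡ (+ 2) _ _ (trans (ℤₚ.*-distribˡ-+ (+ 2) (+ j) p)
      (trans (cong (_+ + 2 * p) (sym (ℤₚ.pos-* 2 j))) (trans eq (ℤₚ.pos-* 2 n))))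

    double-eq : ∀ p → + j + p ≡ + n → + (2 ℕ.* j) + + 2 * p ≡ + (2 ℕ.* n)
    double-eq p eq = trans (cong (_+ + 2 * p) (ℤₚ.pos-* 2 j)) (trans (sym (ℤₚ.*-distribˡ-+ (+ 2) (+ j) p))
      (trans (cong (+ 2 *_) eq) (sym (ℤₚ.pos-* 2 n))))

    move-2ʳ : ∀ d e → d * (+ 2 * e) ≡ + 2 * (d * e)
    move-2ʳ = solve-∀

    product-even : ∀ b y → + (2 ℕ.* j) + b * y ≡ + (2 ℕ.* n) → ε (b * y) ≡ 1ℤ
    product-even b y eq = begin
      ε (b * y)                     ≡⟨ ℤₚ.*-identityˡ _ ⟨
      1ℤ * ε (b * y)                ≡⟨ cong (_* ε (b * y)) (ε-2n j) ⟨
      ε (+ (2 ℕ.* j)) * ε (b * y)   ≡⟨ ε-+ (+ (2 ℕ.* j)) (b * y) ⟨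
      ε (+ (2 ℕ.* j) + b * y)       ≡⟨ cong ε eq ⟩
      ε (+ (2 ℕ.* n))               ≡⟨ ε-2n n ⟩
      1ℤ                            ∎
      where open ≡-Reasoning

    cofactor-even : ∀ b y → Pos y → ε b ≡ - 1ℤ → ε (b * y) ≡ 1ℤ → ε y ≡ 1ℤ
    cofactor-even b y (pos q) b-odd by-even = trans (sym (ε-odd-* b (suc q) b-odd)) by-even

    -- If `b` is odd in `b y = 2 (n - j)`, then `y` is even and can be halved; the coefficient
    -- `3 - 5 ε b` is 8.
    odd-part : ∑ᴱ (D₂ ∩ odd?) g ≡ ∑ᴱ (D n j ∩ odd?) (λ (d , _) → + 8 * d)
    odd-part = reindex (D₂ ∩ odd?) (D n j ∩ odd?)
      (λ (b , y) → b , half y) (λ (d , e) → d , + 2 * e)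
      (λ (b , y) ((b>0 , y>0 , eq) , b-odd) →
        let y-even = cofactor-even b y y>0 b-odd (product-even b y eq)
        in (b>0 , Pos-half y y>0 y-even , halve-eq (b * half y)
             (trans (cong (λ s → + (2 ℕ.* j) + s) (trans (sym (move-2ʳ b (half y))) (cong (b *_) (double-half y y>0 y-even)))) eq))
           , b-odd)
      (λ (d , e) ((d>0 , e>0 , eq) , d-odd) →
        (d>0 , Pos-* (pos 1) e>0 , trans (cong (λ s → + (2 ℕ.* j) + s) (move-2ʳ d e)) (double-eq (d * e) eq)) , d-odd)
      (λ (b , y) ((b>0 , y>0 , eq) , b-odd) →
        cong (b ,_) (double-half y y>0 (cofactor-even b y y>0 b-odd (product-even b y eq))))
      (λ (d , e) ((_ , e>0 , _) , _) → cong (d ,_) (half-double e e>0))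
      (λ (b , y) (_ , b-odd) → trans (cong (λ s → b * (+ 3 - + 5 * s)) b-odd) (ℤₚ.*-comm b (+ 8)))

    -- If `b` is even, halving `b` reaches every factorisation of `n - j`, and `-2b` becomes `-4d`.
    even-part : ∑ᴱ (D₂ ∩ λ de → ¬? (odd? de)) g ≡ ∑ᴱ (D n j) (λ (d , _) → - + 4 * d)
    even-part = reindex (D₂ ∩ λ de → ¬? (odd? de)) (D n j)
      (λ (b , y) → half b , y) (λ (d , e) → + 2 * d , e)
      (λ (b , y) ((b>0 , y>0 , eq) , ¬odd) →
        let b-even = not-odd⇒even b ¬odd
        in Pos-half b b>0 b-even , y>0 , halve-eq (half b * y)
             (trans (cong (λ s → + (2 ℕ.* j) + s) (trans (sym (ℤₚ.*-assoc (+ 2) (half b) y)) (cong (_* y) (double-half b b>0 b-even)))) eq))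
      (λ (d , e) (d>0 , e>0 , eq) →
        (Pos-* (pos 1) d>0 , e>0 , trans (cong (λ s → + (2 ℕ.* j) + s) (ℤₚ.*-assoc (+ 2) d e)) (double-eq (d * e) eq))
        , even⇒not-odd (+ 2 * d) (ε-2* d))
      (λ (b , y) ((b>0 , _ , _) , ¬odd) → cong (_, y) (double-half b b>0 (not-odd⇒even b ¬odd)))
      (λ (d , e) (d>0 , _ , _) → cong (_, e) (half-double d d>0))
      (λ (b , y) ((b>0 , _ , _) , ¬odd) → trans (cong (λ s → b * (+ 3 - + 5 * s)) (not-odd⇒even b ¬odd))
        (trans (cong (_* (+ 3 - + 5 * 1ℤ)) (sym (double-half b b>0 (not-odd⇒even b ¬odd)))) (scale (half b))))
      where
      scale : ∀ h → + 2 * h * (+ 3 - + 5 * 1ℤ) ≡ - + 4 * h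
      scale = solve-∀

  -- An odd divisor `d` of `n - j` receives `8d - 4d`, an even one only `-4d`.
  doubled-altσ : ∑ᴱ (D (2 ℕ.* n) (2 ℕ.* j)) (λ (b , _) → b * (+ 3 - + 5 * ε b)) ≡ + 4 * altσ n j
  doubled-altσ = begin
    ∑ᴱ D₂ g
      ≡⟨ split D₂ odd? g ⟩
    ∑ᴱ (D₂ ∩ odd?) g + ∑ᴱ (D₂ ∩ λ de → ¬? (odd? de)) g
      ≡⟨ cong₂ _+_ (trans odd-part (∑-filter odd? _ (list (D n j)))) even-part ⟩
    ∑ᴱ (D n j) (λ de → ind (odd? de) (+ 8 * proj₁ de)) + ∑ᴱ (D n j) (λ (d , _) → - + 4 * d)
      ≡⟨ ∑-+ _ _ (list (D n j)) ⟨
    ∑ᴱ (D n j) (λ de → ind (odd? de) (+ 8 * proj₁ de) + - + 4 * proj₁ de)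
      ≡⟨ ∑-cong (list (D n j)) pointwise ⟩
    ∑ᴱ (D n j) (λ de → + 4 * signed de)
      ≡⟨ ∑-*ˡ (+ 4) signed (list (D n j)) ⟩
    + 4 * altσ n j ∎
    where
    open ≡-Reasoning
    odd-case : ∀ d → + 8 * d + - + 4 * d ≡ + 4 * (- - 1ℤ * d)
    odd-case = solve-∀
    even-case : ∀ d → 0ℤ + - + 4 * d ≡ + 4 * (- 1ℤ * d)
    even-case = solve-∀
    pointwise : ∀ de → ind (odd? de) (+ 8 * proj₁ de) + - + 4 * proj₁ de ≡ + 4 * signed de
    pointwise (d , e) with ε-values d
    ... | inj₂ odd  = trans (cong (_+ - + 4 * d) (ind-true (odd? (d , e)) odd))
                        (trans (odd-case d) (cong (λ s → + 4 * (- s * d)) (sym odd)))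
    ... | inj₁ even = trans (cong (_+ - + 4 * d) (ind-false (odd? (d , e)) (even⇒not-odd d even)))
                        (trans (even-case d) (cong (λ s → + 4 * (- s * d)) (sym even)))

module _ (n : ℕ) where

  private
    N : ℕ
    N = 1 ℕ.+ 2 ℕ.* n

    second-even? : Decidable {A = ℤ⁴} (λ (_ , b , _ , y) → ε (b * y) ≡ 1ℤ)
    second-even? (_ , b , _ , y) = ε (b * y) ℤₚ.≟ 1ℤ

    Sᵉ : Enum (λ s → InS N s × ε (proj₁ (proj₂ s) * proj₂ (proj₂ (proj₂ s))) ≡ 1ℤ)
    Sᵉ = S N ∩ second-even?

    Sᵒ : Enum (λ s → InS N s × ¬ ε (proj₁ (proj₂ s) * proj₂ (proj₂ (proj₂ s))) ≡ 1ℤ)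
    Sᵒ = S N ∩ λ s → ¬? (second-even? s)

    open Liouville N sq sq-even refl using (exchange; exchange-ok)

    parities : ∀ p q → p + q ≡ + N → ε p * ε q ≡ - 1ℤ
    parities p q eq = trans (sym (ε-+ p q)) (trans (cong ε eq) (ε-1+2n n))

    opposite : ∀ p q → p + q ≡ + N → ε q ≡ 1ℤ → ε p ≡ - 1ℤ
    opposite p q eq εq = trans (sym (ℤₚ.*-identityʳ _)) (trans (cong (ε p *_) (sym εq)) (parities p q eq))

    opposite⁻ : ∀ p q → p + q ≡ + N → ¬ ε q ≡ 1ℤ → ε p ≡ 1ℤ
    opposite⁻ p q eq ¬εq with ε-values p
    ... | inj₁ even = even
    ... | inj₂ odd  = ⊥-elim (¬εq (ℤₚ.neg-injective (trans (sym (ℤₚ.-1*i≡-i _)) (trans (cong (_* ε q) (sym odd)) (parities p q eq)))))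

    -- Exactly one of `a x`, `b y` is even because their sum is odd; `exchange` swaps the two cases.
    Sᵉ≡Sᵒ : ∑ᴱ Sᵉ product-term ≡ ∑ᴱ Sᵒ product-term
    Sᵉ≡Sᵒ = reindex Sᵉ Sᵒ exchange exchange
      (λ (a , b , x , y) (inS@(_ , _ , _ , _ , eq) , even) → exchange-ok (a , b , x , y) inS ,
        λ ax-even → even⇒not-odd (a * x) ax-even (opposite (a * x) (b * y) eq even))
      (λ (a , b , x , y) (inS@(_ , _ , _ , _ , eq) , ¬even) → exchange-ok (a , b , x , y) inS ,
        opposite⁻ (a * x) (b * y) eq ¬even)
      (λ _ _ → refl) (λ _ _ → refl)
      (λ (a , b , _) _ → cong₂ (λ p s → p * (+ 3 + + 5 * ε s)) (ℤₚ.*-comm a b) (ℤₚ.+-comm a b))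

    Fibre : ℕ → (ℤ × ℤ) × (ℤ × ℤ) → Set
    Fibre j (ax , by) = D-cond (1 ℕ.+ 2 ℕ.* j) 0 ax × D-cond (2 ℕ.* n) (2 ℕ.* j) by

    fibre : ∀ j → Enum (Fibre j)
    fibre j = D (1 ℕ.+ 2 ℕ.* j) 0 ⊗ D (2 ℕ.* n) (2 ℕ.* j)

    fibres : Enum (λ t → proj₁ t ℕ.< n × Fibre (proj₁ t) (proj₂ t))
    fibres = below n ▹ fibre

    φ : ℤ⁴ → ℕ × (ℤ × ℤ) × (ℤ × ℤ)
    φ (a , b , x , y) = ℕ.⌊ ∣ a * x ∣ /2⌋ , (a , x) , (b , y)

    ψ : ℕ × (ℤ × ℤ) × (ℤ × ℤ) → ℤ⁴
    ψ (_ , (a , x) , (b , y)) = a , b , x , y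

    odd-value : ∀ p → Pos p → ε p ≡ - 1ℤ → p ≡ + (1 ℕ.+ 2 ℕ.* ℕ.⌊ ∣ p ∣ /2⌋)
    odd-value _ (pos m) εp = cong +_ (trans (odd-half (suc m) εp) (cong suc (cong (h ℕ.+_) (sym (ℕₚ.+-identityʳ h)))))
      where
      h : ℕ
      h = ℕ.⌊ suc m /2⌋

    φ-ok : ∀ s → InS N s × ε (proj₁ (proj₂ s) * proj₂ (proj₂ (proj₂ s))) ≡ 1ℤ → proj₁ (φ s) ℕ.< n × Fibre (proj₁ (φ s)) (proj₂ (φ s))
    φ-ok (a , b , x , y) ((a>0 , b>0 , x>0 , y>0 , eq) , even) =
      bound (Pos-* b>0 y>0) rest , (a>0 , x>0 , trans (ℤₚ.+-identityˡ _) ax≡) , b>0 , y>0 , rest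
      where
      j : ℕ
      j = ℕ.⌊ ∣ a * x ∣ /2⌋
      ax≡ : a * x ≡ + (1 ℕ.+ 2 ℕ.* j)
      ax≡ = odd-value (a * x) (Pos-* a>0 x>0) (opposite (a * x) (b * y) eq even)
      rest : + (2 ℕ.* j) + b * y ≡ + (2 ℕ.* n)
      rest = ∙-cancelˡ 1ℤ _ _ (trans (sym (ℤₚ.+-assoc 1ℤ (+ (2 ℕ.* j)) (b * y))) (trans (cong (_+ b * y) (sym ax≡)) eq))
      bound : ∀ {q} → Pos q → + (2 ℕ.* j) + q ≡ + (2 ℕ.* n) → j ℕ.< n
      bound (pos r) e = ℕₚ.*-cancelˡ-< 2 j n (ℕₚ.≤-trans (ℕₚ.m<m+n (2 ℕ.* j) {suc r} (ℕ.s≤s ℕ.z≤n)) (ℕₚ.≤-reflexive (ℤₚ.+-injective e)))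

    ψ-ok : ∀ t → proj₁ t ℕ.< n × Fibre (proj₁ t) (proj₂ t) → InS N (ψ t) × ε (proj₁ (proj₂ (ψ t)) * proj₂ (proj₂ (proj₂ (ψ t)))) ≡ 1ℤ
    ψ-ok (j , (a , x) , (b , y)) (_ , (a>0 , x>0 , ax) , b>0 , y>0 , by) = (a>0 , b>0 , x>0 , y>0 , eq) , even
      where
      ax≡ : a * x ≡ + (1 ℕ.+ 2 ℕ.* j)
      ax≡ = trans (sym (ℤₚ.+-identityˡ _)) ax
      eq : a * x + b * y ≡ + N
      eq = trans (cong (_+ b * y) ax≡) (trans (ℤₚ.+-assoc 1ℤ (+ (2 ℕ.* j)) (b * y)) (cong (λ s → 1ℤ + s) by))
      even : ε (b * y) ≡ 1ℤ
      even = ℤₚ.neg-injective (trans (sym (ℤₚ.-1*i≡-i _)) (trans (cong (_* ε (b * y)) (sym (trans (cong ε ax≡) (ε-1+2n j)))) (parities (a * x) (b * y) eq)))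

    -- With `b y` even, write `a x = 2j + 1` and `b y = 2 (n - j)`. As `a` is odd,
    -- `ε (a + b) = - ε b`, so the summand is `a` times a function of `b`, and each fibre over `j`
    -- is a product of two divisor sums.
    Sᵉ-sum : ∑ᴱ Sᵉ product-term ≡ ∑[ j ∈ downFrom n ] σ′ (1 ℕ.+ 2 ℕ.* j) * (+ 4 * altσ n j)
    Sᵉ-sum = trans (reindex Sᵉ fibres {g = λ (_ , (a , _) , (b , _)) → a * (b * (+ 3 - + 5 * ε b))} φ ψ φ-ok ψ-ok (λ _ _ → refl) φψ same)
      (trans (∑-▹ (below n) fibre _) (∑-cong (downFrom n) λ j →
        trans (∑-⊗ (D (1 ℕ.+ 2 ℕ.* j) 0) (D (2 ℕ.* n) (2 ℕ.* j)) proj₁ (λ (b , _) → b * (+ 3 - + 5 * ε b)))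
              (cong (σ′ (1 ℕ.+ 2 ℕ.* j) *_) (doubled-altσ n j))))
      where
      φψ : ∀ t → proj₁ t ℕ.< n × Fibre (proj₁ t) (proj₂ t) → φ (ψ t) ≡ t
      φψ (j , (a , x) , (b , y)) (_ , (_ , _ , ax) , _) = cong (_, (a , x) , (b , y))
        (trans (cong (λ p → ℕ.⌊ ∣ p ∣ /2⌋) (trans (sym (ℤₚ.+-identityˡ (a * x))) ax))
               (trans (cong (λ k → ℕ.⌊ suc k /2⌋) (cong (j ℕ.+_) (ℕₚ.+-identityʳ j))) (sym (ℕₚ.n≡⌈n+n/2⌉ j))))
      same : ∀ s → InS N s × ε (proj₁ (proj₂ s) * proj₂ (proj₂ (proj₂ s))) ≡ 1ℤ →
             product-term s ≡ proj₁ s * (proj₁ (proj₂ s) * (+ 3 - + 5 * ε (proj₁ (proj₂ s))))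
      same (a , b , x , y) ((_ , _ , x>0 , _ , eq) , even) =
        trans (cong (λ s → a * b * (+ 3 + + 5 * s)) (trans (ε-+ a b) (cong (_* ε b) a-odd))) (assoc a b (ε b))
        where
        a-odd : ε a ≡ - 1ℤ
        a-odd = ε-factor a x x>0 (opposite (a * x) (b * y) eq even)
        assoc : ∀ a b s → a * b * (+ 3 + + 5 * (- 1ℤ * s)) ≡ a * (b * (+ 3 - + 5 * s))
        assoc = solve-∀

  odd-σ-convolution : + 4 * (∑[ j ∈ downFrom n ] σ′ (1 ℕ.+ 2 ℕ.* j) * altσ n j) ≡ + n * σ′ (1 ℕ.+ 2 ℕ.* n)
  odd-σ-convolution = ℤₚ.*-cancelˡ-≡ (+ 8) _ _ (begin
    + 8 * (+ 4 * W)                      ≡⟨ regroup W ⟩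
    + 4 * (+ 4 * W + + 4 * W)            ≡⟨ cong (λ s → + 4 * (s + s)) (trans (sym (∑-*ˡ (+ 4) _ (downFrom n))) (∑-cong (downFrom n) λ j → move (σ′ (1 ℕ.+ 2 ℕ.* j)) (altσ n j))) ⟩
    + 4 * (V + V)                        ≡⟨ cong (λ s → + 4 * (s + s)) Sᵉ-sum ⟨
    + 4 * (∑ᴱ Sᵉ product-term + ∑ᴱ Sᵉ product-term) ≡⟨ cong (λ s → + 4 * (∑ᴱ Sᵉ product-term + s)) Sᵉ≡Sᵒ ⟩
    + 4 * (∑ᴱ Sᵉ product-term + ∑ᴱ Sᵒ product-term) ≡⟨ cong (+ 4 *_) (split (S N) second-even? product-term) ⟨
    + 4 * ∑ᴱ (S N) product-term          ≡⟨ S-sum n ⟩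
    + 8 * + n * σ′ N                     ≡⟨ ℤₚ.*-assoc (+ 8) (+ n) (σ′ N) ⟩
    + 8 * (+ n * σ′ N)                   ∎)
    where
    open ≡-Reasoning
    W V : ℤ
    W = ∑[ j ∈ downFrom n ] σ′ (1 ℕ.+ 2 ℕ.* j) * altσ n j
    V = ∑[ j ∈ downFrom n ] σ′ (1 ℕ.+ 2 ℕ.* j) * (+ 4 * altσ n j)
    regroup : ∀ w → + 8 * (+ 4 * w) ≡ + 4 * (+ 4 * w + + 4 * w)
    regroup = solve-∀
    move : ∀ s a → + 4 * (s * a) ≡ s * (+ 4 * a)
    move = solve-∀

-- Sums of four triangular numbers

length-∑ : {A : Set} (xs : List A) → + length xs ≡ ∑ xs (λ _ → 1ℤ)
length-∑ []       = refl
length-∑ (x ∷ xs) = cong (λ s → 1ℤ + s) (length-∑ xs)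

below↑ : (n : ℕ) → Enum (ℕ._< n)
list     (below↑ n) = upTo n
unique   (below↑ n) = Uniqueₚ.upTo⁺ n
sound    (below↑ n) = ∈-upTo⁻
complete (below↑ n) = ∈-upTo⁺

∑-upTo : ∀ n (f : ℕ → ℤ) → ∑ (upTo n) f ≡ ∑ (downFrom n) f
∑-upTo n f = reindex-id (below↑ n) (below n) (λ _ p → p) (λ _ p → p)

∑-select-none : ∀ K x (h : ℕ → ℤ) → K ℕ.≤ x → ∑[ j ∈ downFrom K ] ind (j ℕ.≟ x) (h j) ≡ 0ℤ
∑-select-none K x h K≤x = trans
  (∑ᴱ-cong (below K) λ j j<K → ind-false (j ℕ.≟ x) (ℕₚ.<⇒≢ (ℕₚ.<-≤-trans j<K K≤x)))
  (∑-zero (downFrom K))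

-- For `x` outside the range no index matches, and the hypothesis supplies `h x = 0`. In use `h` is
-- `altσ n`, which vanishes from `n` on.
∑-select : ∀ K x (h : ℕ → ℤ) → (K ℕ.≤ x → h x ≡ 0ℤ) → ∑[ j ∈ downFrom K ] ind (j ℕ.≟ x) (h j) ≡ h x
∑-select zero    x h out = sym (out ℕ.z≤n)
∑-select (suc K) x h out with K ℕ.≟ x
... | yes refl = trans (cong (λ s → h x + s) (∑-select-none K x h ℕₚ.≤-refl)) (ℤₚ.+-identityʳ _)
... | no K≢x   = trans (ℤₚ.+-identityˡ _) (∑-select K x h λ K≤x → out (ℕₚ.≤∧≢⇒< K≤x K≢x))

ℕ⁴ : Set
ℕ⁴ = ℕ × ℕ × ℕ × ℕ

T : ℕ⁴ → ℕ
T (a , b , c , d) = tri a ℕ.+ tri b ℕ.+ tri c ℕ.+ tri d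

Bounded : ℕ → ℕ⁴ → Set
Bounded K (a , b , c , d) = a ℕ.< K × b ℕ.< K × c ℕ.< K × d ℕ.< K

box : ∀ K → Enum (Bounded K)
box K = below K ⊗ below K ⊗ below K ⊗ below K

∑-box : ∀ K (f : ℕ⁴ → ℤ) → ∑ᴱ (box K) f ≡
  ∑[ a ∈ downFrom K ] ∑[ b ∈ downFrom K ] ∑[ c ∈ downFrom K ] ∑[ d ∈ downFrom K ] f (a , b , c , d)
∑-box K f = trans (∑-▹ B (λ _ → B ⊗ B ⊗ B) f) (∑-cong (list B) λ a →
  trans (∑-▹ B (λ _ → B ⊗ B) _) (∑-cong (list B) λ b → ∑-▹ B (λ _ → B) _))
  where
  B : Enum (ℕ._< K)
  B = below K

quadruples : List ℕ → List ℕ⁴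
quadruples U = concatMap (λ a → concatMap (λ b → concatMap (λ c → map (λ d → a , b , c , d) U) U) U) U

∑-quadruples : ∀ K (f : ℕ⁴ → ℤ) → ∑ (quadruples (upTo K)) f ≡ ∑ᴱ (box K) f
∑-quadruples K f = trans
  (trans (∑-concatMap f _ U) (trans (∑-cong U λ a → trans (∑-concatMap f _ U)
    (trans (∑-cong U λ b → trans (∑-concatMap f _ U)
      (trans (∑-cong U λ c → trans (∑-map f _ U) (∑-upTo K _)) (∑-upTo K _)))
    (∑-upTo K _))) (∑-upTo K _)))
  (sym (∑-box K f))
  where
  U : List ℕ
  U = upTo K

T-bounds : ∀ K q → T q ℕ.< K → Bounded K q
T-bounds K (a , b , c , d) T<K =
  ℕₚ.≤-<-trans (k≤tri a) (ℕₚ.≤-<-trans (ℕₚ.m≤m+n (tri a) (tri b)) ab<) ,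
  ℕₚ.≤-<-trans (k≤tri b) (ℕₚ.≤-<-trans (ℕₚ.m≤n+m (tri b) (tri a)) ab<) ,
  ℕₚ.≤-<-trans (k≤tri c) (ℕₚ.≤-<-trans (ℕₚ.m≤n+m (tri c) (tri a ℕ.+ tri b)) abc<) ,
  ℕₚ.≤-<-trans (k≤tri d) (ℕₚ.≤-<-trans (ℕₚ.m≤n+m (tri d) (tri a ℕ.+ tri b ℕ.+ tri c)) T<K)
  where
  abc< : tri a ℕ.+ tri b ℕ.+ tri c ℕ.< K
  abc< = ℕₚ.≤-<-trans (ℕₚ.m≤m+n _ (tri d)) T<K
  ab< : tri a ℕ.+ tri b ℕ.< K
  ab< = ℕₚ.≤-<-trans (ℕₚ.m≤m+n _ (tri c)) abc<

-- All solutions of `T q = m` lie in every box of side greater than `m`. `t₄ m` counts in a box of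
-- side `m + 1`, while the recursion needs one box common to all `j`.
count-quadruples : ∀ J K m → m ℕ.< J → m ℕ.< K →
  + length (filter (λ q → m ℕ.≟ T q) (quadruples (upTo J))) ≡ ∑ᴱ (box K) (λ q → ind (m ℕ.≟ T q) 1ℤ)
count-quadruples J K m m<J m<K = begin
  + length (filter T? (quadruples (upTo J)))       ≡⟨ length-∑ (filter T? (quadruples (upTo J))) ⟩
  ∑ (filter T? (quadruples (upTo J))) (λ _ → 1ℤ)   ≡⟨ ∑-filter T? (λ _ → 1ℤ) (quadruples (upTo J)) ⟩
  ∑ (quadruples (upTo J)) (λ q → ind (T? q) 1ℤ)    ≡⟨ ∑-quadruples J (λ q → ind (T? q) 1ℤ) ⟩
  ∑ᴱ (box J) (λ q → ind (T? q) 1ℤ)                 ≡⟨ ∑-filter T? (λ _ → 1ℤ) (list (box J)) ⟨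
  ∑ᴱ (box J ∩ T?) (λ _ → 1ℤ)
    ≡⟨ reindex-id (box J ∩ T?) (box K ∩ T?)
         (λ { q (_ , refl) → T-bounds K q m<K , refl })
         (λ { q (_ , refl) → T-bounds J q m<J , refl }) ⟩
  ∑ᴱ (box K ∩ T?) (λ _ → 1ℤ)                       ≡⟨ ∑-filter T? (λ _ → 1ℤ) (list (box K)) ⟩
  ∑ᴱ (box K) (λ q → ind (T? q) 1ℤ)                 ∎
  where
  open ≡-Reasoning
  T? : Decidable (λ q → m ≡ T q)
  T? q = m ℕ.≟ T q

t₄-box : ∀ K m → m ℕ.< K → + t₄ m ≡ ∑ᴱ (box K) (λ q → ind (m ℕ.≟ T q) 1ℤ)
t₄-box K m m<K = count-quadruples (suc m) K m (ℕₚ.n<1+n m) m<K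

altσ-zero : ∀ n x → n ℕ.≤ x → altσ n x ≡ 0ℤ
altσ-zero n x n≤x = trans (∑ᴱ-cong (D n x) λ de p → ⊥-elim (empty de p)) (∑-zero (list (D n x)))
  where
  empty : ∀ de → ¬ D-cond n x de
  empty _ (pos p , pos q , eq) = ℕₚ.<⇒≱ (ℕₚ.≤-trans (ℕₚ.m<m+n x {suc p ℕ.* suc q} (ℕ.s≤s ℕ.z≤n)) (ℕₚ.≤-reflexive (ℤₚ.+-injective eq))) n≤x

altσ-shift : ∀ g m x → altσ (g ℕ.+ m) (g ℕ.+ x) ≡ altσ m x
altσ-shift g m x = reindex-id (D (g ℕ.+ m) (g ℕ.+ x)) (D m x)
  (λ (d , e) (d>0 , e>0 , eq) → d>0 , e>0 , ∙-cancelˡ (+ g) _ _ (trans (sym (ℤₚ.+-assoc (+ g) (+ x) (d * e))) eq))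
  (λ (d , e) (d>0 , e>0 , eq) → d>0 , e>0 , trans (ℤₚ.+-assoc (+ g) (+ x) (d * e)) (cong (λ s → + g + s) eq))

-- The identity for `ψ` multiplied by `q^g`, where `g` will be the total of three fixed triangular
-- numbers. For `n < g` both sides vanish; otherwise `n = g + m` and the coefficient at `m` is used.
ψ-log-derivative-shifted : ∀ K n g → n ℕ.< K →
  (∑[ d ∈ downFrom K ] ind (n ℕ.≟ g ℕ.+ tri d) (+ tri d)) ≡ (∑[ d ∈ downFrom K ] altσ n (g ℕ.+ tri d))
ψ-log-derivative-shifted K n g n<K with g ℕ.≤? n
... | no g≰n = trans
  (trans (∑-cong (downFrom K) λ d → ind-false (n ℕ.≟ g ℕ.+ tri d) λ eq → g≰n (ℕₚ.≤-trans (ℕₚ.m≤m+n g (tri d)) (ℕₚ.≤-reflexive (sym eq))))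
         (∑-zero (downFrom K)))
  (sym (trans (∑-cong (downFrom K) λ d → altσ-zero n (g ℕ.+ tri d) (ℕₚ.≤-trans (ℕₚ.<⇒≤ (ℕₚ.≰⇒> g≰n)) (ℕₚ.m≤m+n g (tri d))))
              (∑-zero (downFrom K))))
... | yes g≤n with m , refl ← ℕₚ.m≤n⇒∃[o]m+o≡n g≤n = begin
  (∑[ d ∈ L ] ind (g ℕ.+ m ℕ.≟ g ℕ.+ tri d) (+ tri d))  ≡⟨ ∑-cong L same ⟩
  (∑[ d ∈ L ] ind (tri d ℕ.≟ m) (+ m))                  ≡⟨ unshifted K (ℕₚ.≤-<-trans (ℕₚ.m≤n+m m g) n<K) ⟨
  (∑[ d ∈ L ] altσ m (tri d))                           ≡⟨ ∑-cong L (λ d → altσ-shift g m (tri d)) ⟨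
  (∑[ d ∈ L ] altσ (g ℕ.+ m) (g ℕ.+ tri d))             ∎
  where
  open ≡-Reasoning
  L : List ℕ
  L = downFrom K
  unshifted : ∀ K → m ℕ.< K → (∑[ d ∈ downFrom K ] altσ m (tri d)) ≡ (∑[ d ∈ downFrom K ] ind (tri d ℕ.≟ m) (+ m))
  unshifted (suc N) (ℕ.s≤s m≤N) = ψ-log-derivative m N m≤N
  same : ∀ d → ind (g ℕ.+ m ℕ.≟ g ℕ.+ tri d) (+ tri d) ≡ ind (tri d ℕ.≟ m) (+ m)
  same d with tri d ℕ.≟ m
  ... | yes refl = ind-true (g ℕ.+ m ℕ.≟ g ℕ.+ tri d) refl
  ... | no  ne   = ind-false (g ℕ.+ m ℕ.≟ g ℕ.+ tri d) λ eq → ne (sym (ℕₚ.+-cancelˡ-≡ g m (tri d) eq))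

module _ (n K : ℕ) (n<K : n ℕ.< K) where

  private
    E : Enum (Bounded K)
    E = box K

    on : ℕ⁴ → ℤ → ℤ
    on q = ind (n ℕ.≟ T q)

    L : List ℕ
    L = downFrom K

    -- Differentiates only the fourth factor of `ψ⁴`: the first three variables stay fixed during
    -- the summation over the last.
    last-sum : ∑ᴱ E (λ q@(_ , _ , _ , d) → on q (+ tri d)) ≡ ∑ᴱ E (λ q → altσ n (T q))
    last-sum = trans (∑-box K _) (trans
      (∑-cong L λ a → ∑-cong L λ b → ∑-cong L λ c → ψ-log-derivative-shifted K n (tri a ℕ.+ tri b ℕ.+ tri c) n<K)
      (sym (∑-box K _)))

    move-last : (π : ℕ⁴ → ℕ⁴) → (∀ q → Bounded K q → Bounded K (π q)) → (∀ q → π (π q) ≡ q) → (∀ q → T (π q) ≡ T q) →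
      ∑ᴱ E (λ q → on q (+ tri (proj₂ (proj₂ (proj₂ (π q)))))) ≡ ∑ᴱ E (λ q@(_ , _ , _ , d) → on q (+ tri d))
    move-last π π-ok ππ Tπ = reindex E E π π π-ok π-ok (λ q _ → ππ q) (λ q _ → ππ q)
      λ q _ → cong (λ s → ind (n ℕ.≟ s) (+ tri (proj₂ (proj₂ (proj₂ (π q)))))) (sym (Tπ q))

    last : ℤ
    last = ∑ᴱ E (λ q@(_ , _ , _ , d) → on q (+ tri d))

    sum-a : ∑ᴱ E (λ q@(a , _) → on q (+ tri a)) ≡ last
    sum-a = move-last (λ (a , b , c , d) → d , b , c , a) (λ _ (p , q , r , s) → s , q , r , p) (λ _ → refl)
      λ (a , b , c , d) → perm (tri a) (tri b) (tri c) (tri d)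
      where
      perm : ∀ a b c d → d ℕ.+ b ℕ.+ c ℕ.+ a ≡ a ℕ.+ b ℕ.+ c ℕ.+ d
      perm = ℕR.solve-∀

    sum-b : ∑ᴱ E (λ q@(_ , b , _) → on q (+ tri b)) ≡ last
    sum-b = move-last (λ (a , b , c , d) → a , d , c , b) (λ _ (p , q , r , s) → p , s , r , q) (λ _ → refl)
      λ (a , b , c , d) → perm (tri a) (tri b) (tri c) (tri d)
      where
      perm : ∀ a b c d → a ℕ.+ d ℕ.+ c ℕ.+ b ≡ a ℕ.+ b ℕ.+ c ℕ.+ d
      perm = ℕR.solve-∀

    sum-c : ∑ᴱ E (λ q@(_ , _ , c , _) → on q (+ tri c)) ≡ last
    sum-c = move-last (λ (a , b , c , d) → a , b , d , c) (λ _ (p , q , r , s) → p , q , s , r) (λ _ → refl)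
      λ (a , b , c , d) → perm (tri a) (tri b) (tri c) (tri d)
      where
      perm : ∀ a b c d → a ℕ.+ b ℕ.+ d ℕ.+ c ≡ a ℕ.+ b ℕ.+ c ℕ.+ d
      perm = ℕR.solve-∀

    -- The product rule in coefficients: where `T q = n`, the factor `n` is the sum of four
    -- triangular numbers, and each position has the same total by symmetry of `T`.
    weigh : + n * + t₄ n ≡ + 4 * last
    weigh = begin
      + n * + t₄ n
        ≡⟨ cong (+ n *_) (t₄-box K n n<K) ⟩
      + n * ∑ᴱ E (λ q → on q 1ℤ)
        ≡⟨ ∑-*ˡ (+ n) _ (list E) ⟨
      ∑ᴱ E (λ q → + n * on q 1ℤ)
        ≡⟨ ∑-cong (list E) spread ⟩
      ∑ᴱ E (λ q@(a , b , c , d) → on q (+ tri a) + (on q (+ tri b) + (on q (+ tri c) + on q (+ tri d))))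
        ≡⟨ trans (∑-+ _ _ (list E)) (cong₂ _+_ sum-a (trans (∑-+ _ _ (list E)) (cong₂ _+_ sum-b (trans (∑-+ _ _ (list E)) (cong (_+ last) sum-c))))) ⟩
      last + (last + (last + last))
        ≡⟨ four last ⟩
      + 4 * last ∎
      where
      open ≡-Reasoning
      four : ∀ z → z + (z + (z + z)) ≡ + 4 * z
      four = solve-∀
      spread : ∀ q → + n * on q 1ℤ ≡ on q (+ tri (proj₁ q)) + (on q (+ tri (proj₁ (proj₂ q))) +
                 (on q (+ tri (proj₁ (proj₂ (proj₂ q)))) + on q (+ tri (proj₂ (proj₂ (proj₂ q))))))
      spread q@(a , b , c , d) with n ℕ.≟ T q
      ... | yes eq = trans (ℤₚ.*-identityʳ (+ n)) (trans (cong +_ eq) (assoc (+ tri a) (+ tri b) (+ tri c) (+ tri d)))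
        where
        assoc : ∀ a b c d → a + b + c + d ≡ a + (b + (c + d))
        assoc = solve-∀
      ... | no _   = ℤₚ.*-zeroʳ (+ n)

    -- Sorts the quadruples by `j = T q`. Those with `T q ≥ K` contribute nothing, since `altσ n` is
    -- zero there.
    collect : ∑ᴱ E (λ q → altσ n (T q)) ≡ ∑[ j ∈ L ] + t₄ j * altσ n j
    collect = begin
      ∑ᴱ E (λ q → altσ n (T q))
        ≡⟨ ∑-cong (list E) (λ q → sym (∑-select K (T q) (altσ n) λ K≤T → altσ-zero n (T q) (ℕₚ.≤-trans (ℕₚ.<⇒≤ n<K) K≤T))) ⟩
      ∑ᴱ E (λ q → ∑[ j ∈ L ] ind (j ℕ.≟ T q) (altσ n j))
        ≡⟨ ∑-swap (λ q j → ind (j ℕ.≟ T q) (altσ n j)) (list E) L ⟩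
      (∑[ j ∈ L ] ∑ᴱ E (λ q → ind (j ℕ.≟ T q) (altσ n j)))
        ≡⟨ ∑ᴱ-cong (below K) term ⟩
      (∑[ j ∈ L ] + t₄ j * altσ n j) ∎
      where
      open ≡-Reasoning
      term : ∀ j → j ℕ.< K → ∑ᴱ E (λ q → ind (j ℕ.≟ T q) (altσ n j)) ≡ + t₄ j * altσ n j
      term j j<K = begin
        ∑ᴱ E (λ q → ind (j ℕ.≟ T q) (altσ n j))
          ≡⟨ ∑-cong (list E) (λ q → trans (cong (ind (j ℕ.≟ T q)) (sym (ℤₚ.*-identityʳ (altσ n j)))) (trans (ind-*ˡ (j ℕ.≟ T q) (altσ n j) 1ℤ) (ℤₚ.*-comm (altσ n j) _))) ⟩
        ∑ᴱ E (λ q → ind (j ℕ.≟ T q) 1ℤ * altσ n j)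
          ≡⟨ ∑-*ʳ (altσ n j) _ (list E) ⟩
        ∑ᴱ E (λ q → ind (j ℕ.≟ T q) 1ℤ) * altσ n j
          ≡⟨ cong (_* altσ n j) (t₄-box K j j<K) ⟨
        + t₄ j * altσ n j ∎

  t₄-recursion-up-to : + n * + t₄ n ≡ + 4 * (∑[ j ∈ downFrom K ] + t₄ j * altσ n j)
  t₄-recursion-up-to = trans weigh (cong (+ 4 *_) (trans last-sum collect))

t₄-recursion : ∀ n → + n * + t₄ n ≡ + 4 * (∑[ j ∈ downFrom n ] + t₄ j * altσ n j)
-- The range `j < n + 1` contains `j = n`, where `t₄ n` itself appears. Its coefficient `altσ n n`
-- is 0, so only earlier values remain.
t₄-recursion n = trans (t₄-recursion-up-to n (suc n) (ℕₚ.n<1+n n)) (cong (+ 4 *_)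
  (trans (cong (_+ (∑[ j ∈ downFrom n ] + t₄ j * altσ n j))
           (trans (cong (+ t₄ n *_) (altσ-zero n n ℕₚ.≤-refl)) (ℤₚ.*-zeroʳ (+ t₄ n))))
         (ℤₚ.+-identityˡ _)))

t₄≡σ′ : ∀ n → + t₄ n ≡ σ′ (1 ℕ.+ 2 ℕ.* n)
t₄≡σ′ = <-rec (λ n → + t₄ n ≡ σ′ (1 ℕ.+ 2 ℕ.* n)) step
  where
  step : ∀ n → (∀ {j} → j ℕ.< n → + t₄ j ≡ σ′ (1 ℕ.+ 2 ℕ.* j)) → + t₄ n ≡ σ′ (1 ℕ.+ 2 ℕ.* n)
  -- Both `t₄ 0` and `σ′ 1` evaluate to 1.
  step zero      ih = refl
  step n@(suc _) ih = ℤₚ.*-cancelˡ-≡ (+ n) _ _ (trans (t₄-recursion n)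
    (trans (cong (+ 4 *_) (∑ᴱ-cong (below n) λ j j<n → cong (_* altσ n j) (ih j<n))) (odd-σ-convolution n)))

-- Divisor sums of rationals

sum-∑ : ∀ xs → + sum xs ≡ ∑[ x ∈ xs ] + x
sum-∑ []       = refl
sum-∑ (x ∷ xs) = cong (λ s → + x + s) (sum-∑ xs)

σ′-divisors : ∀ k → + σℕ (suc k) ≡ σ′ (suc k)
σ′-divisors k = trans (sum-∑ (filter (_∣? m) (upTo (suc m)))) (reindex divisors (D m 0) φ (λ (d , _) → ∣ d ∣) φ-ok ψ-ok (λ _ _ → refl) φψ (λ _ _ → refl))
  where
  m : ℕ
  m = suc k
  divisors : Enum (λ d → d ℕ.< suc m × d ∣ m)
  divisors = below↑ (suc m) ∩ (_∣? m)
  cofactor : ℕ → ℕ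
  cofactor d with d ∣? m
  ... | yes (divides q _) = q
  -- An arbitrary default: `φ` is applied to divisors of `m` only.
  ... | no _              = 0
  cofactor-* : ∀ d → d ∣ m → m ≡ cofactor d ℕ.* d
  cofactor-* d d∣m with d ∣? m
  ... | yes (divides q eq) = eq
  ... | no ¬d∣m            = ⊥-elim (¬d∣m d∣m)
  φ : ℕ → ℤ × ℤ
  φ d = + d , + cofactor d
  φ-ok : ∀ d → d ℕ.< suc m × d ∣ m → D-cond m 0 (φ d)
  φ-ok d (_ , d∣m) = positive d (cofactor d) (cofactor-* d d∣m)
    where
    positive : ∀ d q → m ≡ q ℕ.* d → D-cond m 0 (+ d , + q)
    positive (suc d) (suc q) eq = pos d , pos q , cong +_ (trans (ℕₚ.*-comm (suc d) (suc q)) (sym eq))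
    -- The range in `σℕ` starts at 0, which does not divide `m = suc k`.
    positive zero    q       eq with () ← trans eq (ℕₚ.*-zeroʳ q)
  ψ-ok : ∀ de → D-cond m 0 de → ∣ proj₁ de ∣ ℕ.< suc m × ∣ proj₁ de ∣ ∣ m
  ψ-ok _ (pos d , pos e , eq) = ℕ.s≤s (∣⇒≤ d∣m) , d∣m
    where
    d∣m : suc d ∣ m
    d∣m = divides (suc e) (trans (sym (ℤₚ.+-injective eq)) (ℕₚ.*-comm (suc d) (suc e)))
  φψ : ∀ de → D-cond m 0 de → φ ∣ proj₁ de ∣ ≡ de
  φψ de@(_ , _) p@(pos d , pos e , eq) = cong (λ q → + suc d , + q) (ℕₚ.*-cancelʳ-≡ (cofactor (suc d)) (suc e) (suc d)
    (trans (sym (cofactor-* (suc d) (proj₂ (ψ-ok de p)))) (trans (sym (ℤₚ.+-injective eq)) (ℕₚ.*-comm (suc d) (suc e)))))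

-- The source of `4 σ(m/2)`: the even divisors of `2h` are the doubles of the divisors of `h`.
even-divisors : ∀ h → ∑ᴱ (D (2 ℕ.* h) 0 ∩ λ de → ¬? (odd? de)) (λ (d , _) → + 2 * d) ≡ + 4 * σ′ h
even-divisors h = trans (reindex (D (2 ℕ.* h) 0 ∩ λ de → ¬? (odd? de)) (D h 0)
    (λ (d , e) → half d , e) (λ (d , e) → + 2 * d , e)
    (λ (d , e) ((d>0 , e>0 , eq) , ¬odd) → Pos-half d d>0 (not-odd⇒even d ¬odd) , e>0 ,
      ℤₚ.*-cancelˡ-≡ (+ 2) (0ℤ + half d * e) (+ h)
        (trans (reassoc (half d) e) (trans (cong (λ s → 0ℤ + s * e) (double-half d d>0 (not-odd⇒even d ¬odd))) (trans eq (ℤₚ.pos-* 2 h)))))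
    (λ (d , e) (d>0 , e>0 , eq) →
      (Pos-* (pos 1) d>0 , e>0 , trans (sym (reassoc d e)) (trans (cong (+ 2 *_) eq) (sym (ℤₚ.pos-* 2 h)))) , even⇒not-odd (+ 2 * d) (ε-2* d))
    (λ (d , e) ((d>0 , _) , ¬odd) → cong (_, e) (double-half d d>0 (not-odd⇒even d ¬odd)))
    (λ (d , e) (d>0 , _) → cong (_, e) (half-double d d>0))
    (λ (d , e) ((d>0 , _) , ¬odd) → trans (cong (+ 2 *_) (sym (double-half d d>0 (not-odd⇒even d ¬odd)))) (sym (ℤₚ.*-assoc (+ 2) (+ 2) (half d)))))
  (∑-*ˡ (+ 4) proj₁ (list (D h 0)))
  where
  reassoc : ∀ d e → + 2 * (0ℤ + d * e) ≡ 0ℤ + + 2 * d * e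
  reassoc = solve-∀

-- Giving an even divisor `d` the sign `-1` lowers the divisor sum by `2d`.
altσ-even-divisors : ∀ m → altσ m 0 ≡ σ′ m - ∑ᴱ (D m 0 ∩ λ de → ¬? (odd? de)) (λ (d , _) → + 2 * d)
altσ-even-divisors m = trans (add-cancel (altσ m 0) V) (cong (_- V) (begin
  altσ m 0 + V                                                         ≡⟨ cong (λ s → altσ m 0 + s) (∑-filter (λ de → ¬? (odd? de)) _ (list (D m 0))) ⟩
  altσ m 0 + ∑ᴱ (D m 0) (λ de → ind (¬? (odd? de)) (+ 2 * proj₁ de))   ≡⟨ ∑-+ _ _ (list (D m 0)) ⟨
  ∑ᴱ (D m 0) (λ de → signed de + ind (¬? (odd? de)) (+ 2 * proj₁ de))  ≡⟨ ∑-cong (list (D m 0)) pointwise ⟩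
  σ′ m                                                                 ∎))
  where
  open ≡-Reasoning
  V : ℤ
  V = ∑ᴱ (D m 0 ∩ λ de → ¬? (odd? de)) (λ (d , _) → + 2 * d)
  add-cancel : ∀ a v → a ≡ a + v - v
  add-cancel = solve-∀
  odd-case : ∀ d → - - 1ℤ * d + 0ℤ ≡ d
  odd-case = solve-∀
  even-case : ∀ d → - 1ℤ * d + + 2 * d ≡ d
  even-case = solve-∀
  pointwise : ∀ de → signed de + ind (¬? (odd? de)) (+ 2 * proj₁ de) ≡ proj₁ de
  pointwise (d , e) with ε-values d
  ... | inj₂ odd  = trans (cong₂ (λ s t → - s * d + t) odd (ind-false (¬? (odd? (d , e))) (λ ¬odd → ¬odd odd))) (odd-case d)
  ... | inj₁ even = trans (cong₂ (λ s t → - s * d + t) even (ind-true (¬? (odd? (d , e))) (even⇒not-odd d even))) (even-case d)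

no-even-divisors : ∀ h → ∑ᴱ (D (1 ℕ.+ 2 ℕ.* h) 0 ∩ λ de → ¬? (odd? de)) (λ (d , _) → + 2 * d) ≡ 0ℤ
no-even-divisors h = trans (∑ᴱ-cong E λ (d , e) ((_ , e>0 , eq) , ¬odd) →
    ⊥-elim (¬odd (ε-factor d e e>0 (trans (cong ε (trans (sym (ℤₚ.+-identityˡ (d * e))) eq)) (ε-1+2n h)))))
  (∑-zero (list E))
  where
  E : Enum (λ de → D-cond (1 ℕ.+ 2 ℕ.* h) 0 de × ¬ ε (proj₁ de) ≡ - 1ℤ)
  E = D (1 ℕ.+ 2 ℕ.* h) 0 ∩ λ de → ¬? (odd? de)

-- `σ` inspects the reduced fraction, which does not compute for a variable `k`. Rewriting it as an
-- explicit coprime fraction lets `σ` reduce.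
σ-ℕ : ∀ k → σ (ℕ→ℚ (suc k)) ≡ σℕ (suc k)
σ-ℕ k = cong σ (ℚₚ.normalize-coprime {suc k} {0} (Coprime.sym (Coprime.1-coprimeTo (suc k))))

σ-half-even : ∀ h → σ ((+ (2 ℕ.* suc h)) ℚ./ 2) ≡ σℕ (suc h)
σ-half-even h = trans (cong σ (ℚₚ.fromℚᵘ-cong {mkℚᵘ (+ (2 ℕ.* suc h)) 1} {mkℚᵘ (+ suc h) 0} (*≡* cross))) (σ-ℕ h)
  where
  cross : + (2 ℕ.* suc h) * 1ℤ ≡ + suc h * + 2
  cross = trans (ℤₚ.*-identityʳ _) (trans (ℤₚ.pos-* 2 (suc h)) (ℤₚ.*-comm (+ 2) (+ suc h)))

-- The fraction is already in lowest terms, so its denominator 2 selects the last clause of `σ`.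
σ-half-odd : ∀ h → σ ((+ (1 ℕ.+ 2 ℕ.* h)) ℚ./ 2) ≡ 0
σ-half-odd h = cong σ (ℚₚ.normalize-coprime {1 ℕ.+ 2 ℕ.* h} {1} coprime)
  where
  coprime : Coprime.Coprime (1 ℕ.+ 2 ℕ.* h) 2
  coprime {d} (d∣odd , d∣2) = ∣1⇒≡1 (∣m+n∣m⇒∣n (subst (d ∣_) (ℕₚ.+-comm 1 (2 ℕ.* h)) d∣odd) (∣-trans d∣2 (m∣m*n h)))

parity : ∀ m → (∃ λ h → m ≡ 2 ℕ.* h) ⊎ (∃ λ h → m ≡ 1 ℕ.+ 2 ℕ.* h)
parity zero = inj₁ (0 , refl)
parity (suc m) with parity m
... | inj₁ (h , refl) = inj₂ (h , refl)
... | inj₂ (h , refl) = inj₁ (suc h , cong suc (sym (ℕₚ.+-suc h (h ℕ.+ 0))))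

σ-altσ : ∀ k → + σ (ℕ→ℚ (suc k)) - + (4 ℕ.* σ ((+ suc k) ℚ./ 2)) ≡ altσ (suc k) 0
σ-altσ k = sym (trans (altσ-even-divisors (suc k)) (cong₂ _-_
  (trans (sym (σ′-divisors k)) (cong +_ (sym (σ-ℕ k)))) (evens (suc k) (parity (suc k)))))
  where
  -- Generalising `suc k` to `m` allows the parity equation to be matched with `refl`; the instance
  -- excludes `m = 0`.
  evens : ∀ m → (∃ λ h → m ≡ 2 ℕ.* h) ⊎ (∃ λ h → m ≡ 1 ℕ.+ 2 ℕ.* h) → {{ℕ.NonZero m}} →
    ∑ᴱ (D m 0 ∩ λ de → ¬? (odd? de)) (λ (d , _) → + 2 * d) ≡ + (4 ℕ.* σ ((+ m) ℚ./ 2))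
  evens _ (inj₁ (suc h , refl)) = trans (even-divisors (suc h))
    (trans (cong (+ 4 *_) (trans (sym (σ′-divisors h)) (cong +_ (sym (σ-half-even h))))) (sym (ℤₚ.pos-* 4 (σ ((+ (2 ℕ.* suc h)) ℚ./ 2)))))
  evens _ (inj₂ (h , refl)) = trans (no-even-divisors h) (cong (λ s → + (4 ℕ.* s)) (sym (σ-half-odd h)))

-- The prime case and the conclusion

σ′-prime : ∀ p → Prime p → σ′ p ≡ 1ℤ + + p
σ′-prime p p-prime = trans (reindex-id (D p 0) trivial to from) (cong (λ s → 1ℤ + s) (ℤₚ.+-identityʳ (+ p)))
  where
  p≢1 : p ≢ 1
  p≢1 refl with () ← prime⇒nonTrivial p-prime
  trivial : Enum (λ de → de ≡ (1ℤ , + p) ⊎ de ≡ (+ p , 1ℤ))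
  list trivial = (1ℤ , + p) ∷ (+ p , 1ℤ) ∷ []
  unique trivial = ((λ eq → p≢1 (ℤₚ.+-injective (sym (cong proj₁ eq)))) ∷ []) ∷ [] ∷ []
  sound trivial (here eq) = inj₁ eq
  sound trivial (there (here eq)) = inj₂ eq
  complete trivial (inj₁ eq) = here eq
  complete trivial (inj₂ eq) = there (here eq)
  to : ∀ de → D-cond p 0 de → de ≡ (1ℤ , + p) ⊎ de ≡ (+ p , 1ℤ)
  to _ (pos d , pos e , eq) with prime⇒irreducible p-prime {suc d} (divides (suc e) (trans (sym (ℤₚ.+-injective eq)) (ℕₚ.*-comm (suc d) (suc e))))
  ... | inj₁ refl = inj₁ (cong (1ℤ ,_) (trans (sym (trans (ℤₚ.+-identityˡ _) (ℤₚ.*-identityˡ (+ suc e)))) eq))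
  ... | inj₂ refl = inj₂ (cong (+ suc d ,_) (cong +_ (ℕₚ.*-cancelˡ-≡ (suc e) 1 (suc d) (trans (ℤₚ.+-injective eq) (sym (ℕₚ.*-identityʳ (suc d)))))))
  p>0 : ∀ p → Prime p → Pos (+ p)
  p>0 zero p-prime with () ← prime⇒nonTrivial p-prime
  p>0 (suc p) _ = pos p
  from : ∀ de → de ≡ (1ℤ , + p) ⊎ de ≡ (+ p , 1ℤ) → D-cond p 0 de
  from _ (inj₁ refl) = pos 0 , p>0 p p-prime , trans (ℤₚ.+-identityˡ _) (ℤₚ.*-identityˡ (+ p))
  from _ (inj₂ refl) = p>0 p p-prime , pos 0 , trans (ℤₚ.+-identityˡ _) (ℤₚ.*-identityʳ (+ p))

Σ<-∑ : ∀ n (f : ℕ → ℤ) → (Σ< n) f ≡ ∑ (downFrom n) f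
Σ<-∑ zero    f = refl
Σ<-∑ (suc n) f = trans (cong (_+ f n) (Σ<-∑ n f)) (ℤₚ.+-comm _ (f n))

σ-term : ∀ n j → j ℕ.< n → + σ (ℕ→ℚ (n ℕ.∸ j)) - + (4 ℕ.* σ ((+ (n ℕ.∸ j)) ℚ./ 2)) ≡ altσ n j
σ-term n j j<n with k , refl ← <⇒∃ j<n = trans
  (cong (λ m → + σ (ℕ→ℚ m) - + (4 ℕ.* σ ((+ m) ℚ./ 2))) (trans (cong (ℕ._∸ j) (sym (ℕₚ.+-suc j k))) (ℕₚ.m+n∸m≡n j (suc k))))
  (trans (σ-altσ k) (trans (sym (altσ-shift j (suc k) 0)) (cong₂ altσ (ℕₚ.+-suc j k) (ℕₚ.+-identityʳ j))))

theorem4p2 : (n : ℕ) → Prime (2 ℕ.* n ℕ.+ 1) →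
    (Σ< n) (λ j → + t₄ j * (+ σ (ℕ→ℚ (n ℕ.∸ j)) - + (4 ℕ.* σ ((+ (n ℕ.∸ j)) ℚ./ 2))))
    ≡ + ((n ℕ.* suc n) ℕ./ 2)
theorem4p2 n p-prime = trans (Σ<-∑ n _) (trans
  (∑ᴱ-cong (below n) λ j j<n → cong (+ t₄ j *_) (σ-term n j j<n))
  -- After multiplication by 4 both sides equal `n (2n + 2)`; `tri n` unfolds to the quotient on the
  -- right-hand side.
  (ℤₚ.*-cancelˡ-≡ (+ 4) _ _ (begin
    + 4 * (∑[ j ∈ downFrom n ] + t₄ j * altσ n j)  ≡⟨ t₄-recursion n ⟨
    + n * + t₄ n                                   ≡⟨ cong (+ n *_) (t₄≡σ′ n) ⟩
    + n * σ′ (1 ℕ.+ 2 ℕ.* n)                       ≡⟨ cong (+ n *_) (σ′-prime (1 ℕ.+ 2 ℕ.* n) (subst Prime (ℕₚ.+-comm (2 ℕ.* n) 1) p-prime)) ⟩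
    + n * (1ℤ + (1ℤ + + (2 ℕ.* n)))                ≡⟨ cong (λ s → + n * (1ℤ + (1ℤ + s))) (ℤₚ.pos-* 2 n) ⟩
    + n * (1ℤ + (1ℤ + + 2 * + n))                  ≡⟨ rearrange (+ n) ⟩
    + 2 * (+ n * (+ n + 1ℤ))                       ≡⟨ cong (+ 2 *_) (k*suc-k n) ⟩
    + 2 * (+ 2 * + tri n)                          ≡⟨ ℤₚ.*-assoc (+ 2) (+ 2) (+ tri n) ⟨
    + 4 * + tri n                                  ∎)))
  where
  open ≡-Reasoning
  rearrange : ∀ n → n * (1ℤ + (1ℤ + + 2 * n)) ≡ + 2 * (n * (n + 1ℤ))
  rearrange = solve-∀
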